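{- Let $n\ge m\ge 1$ be integers, $N=nm+n+m$, and $d\in\{1,-1\}$. Put $s_1=m(m+3)/2$ and $s_2=(n-m)(m+1)$, and define integers $x_1,\dots,x_N$ recursively as follows. For $1\le i\le s_1$, with $\alpha=\lfloor\frac{\sqrt{8i+1}-1}{2}\rfloor$, $$x_i=n+1-(-1)^{\alpha}d\,(2i-\alpha(\alpha+2)).$$ For $s_1+1\le i\le s_1+s_2$, with $\beta=\lfloor\frac{i-s_1+m}{m+1}\rfloor$ and $p=i-s_1-(\beta-1)(m+1)$, $$x_i=x_{s_1}-\beta-(-1)^{m+\beta}d\,\bigl(2p-2-m(1+(-1)^{\beta})\bigr).$$ For $s_1+s_2+1\le i\le N$, with $\gamma=\lfloor m-\sqrt{m(m+1)-2(i-s_1-s_2)+9/4}+3/2\rfloor$ and $q=i-s_1-s_2-(\gamma-1)(m+1)+\gamma(\gamma-1)/2$, $$x_i=x_{s_1+s_2}-d\bigl((-1)^{n+\gamma}(\gamma+2q-m-2)-m(-1)^n\bigr).$$ Then starting from the initial configuration $b^nOw^m$ and, for $i=1,\dots,N$, moving in step $i$ the checker at position $x_i$ into the current vacancy, every step is a legal move, the final configuration $w^mOb^n$ is reached after step $N$, and hence this is an optimal move sequence (of the minimum possible length $nm+n+m$). Moreover $d=(n+1)-x_1$ is the direction of the first move.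
   Context: The game: positions $1,\dots,n+m+1$ in a row, each holding a black checker ($b$), a white checker ($w$) or nothing, with exactly one empty position (the vacancy $O$). Initial configuration $b^nOw^m$ (vacancy at position $n+1$), final configuration $w^mOb^n$. A legal move is a slide (a checker adjacent to the vacancy moves into it) or a jump (a checker at distance two from the vacancy jumps over the checker between them into it); after moving the checker at position $x_i$, position $x_i$ becomes the new vacancy. -}

module Defs where

open import Data.Bool using (if_then_else_)
open import Data.Integer as ℤ using (ℤ; +_; 1ℤ; -1ℤ)
import Data.Integer.DivMod as ℤ
import Data.Integer.Properties as ℤ
open import Data.Integer.Solver using (module +-*-Solver)
open import Data.List using (List; []; _∷_; _++_; length; replicate; applyUpTo)
open import Data.Nat as ℕ using (ℕ; zero; suc; _≤ᵇ_)
import Data.Nat.DivMod as ℕ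
import Data.Nat.Properties as ℕ
open import Data.Product using (_×_; _,_)
open import Data.Rational.Unnormalised as ℚᵘ using (ℚᵘ; mkℚᵘ; 0ℚᵘ; 1ℚᵘ; ½; -½; ↥_; *≤*; nonNegative)
import Data.Rational.Unnormalised.Properties as ℚᵘ
open import Relation.Binary using (Decidable)
open import Relation.Binary.PropositionalEquality
open import Relation.Nullary using (¬_; yes; no)

------------------------------------------------------------------------
-- Real numbers of the form p + q √ s, and their integer part

infix 6 _⊕_√_
infix 4 _≤ˢ_ _ˢ<_ _≤ˢ?_

-- p ⊕ q √ s stands for the real number p + q √s, for s ≥ 0.
record Surd : Set where
  constructor _⊕_√_
  field
    rat coeff radicand : ℚᵘ

-- The map t ↦ t ∣t∣ is strictly increasing on the reals and sends q √s to
-- q ∣q∣ s, so comparing r with p + q √s amounts to comparing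
-- (r - p) ∣r - p∣ with q ∣q∣ s.
signedSquare : ℚᵘ → ℚᵘ
signedSquare t = t ℚᵘ.* ℚᵘ.∣ t ∣

_≤ˢ_ : ℤ → Surd → Set
a ≤ˢ (p ⊕ q √ s) = signedSquare (a ℚᵘ./ 1 ℚᵘ.- p) ℚᵘ.≤ signedSquare q ℚᵘ.* s

_ˢ<_ : Surd → ℤ → Set
(p ⊕ q √ s) ˢ< a = signedSquare q ℚᵘ.* s ℚᵘ.< signedSquare (a ℚᵘ./ 1 ℚᵘ.- p)

_≤ˢ?_ : Decidable _≤ˢ_
a ≤ˢ? (p ⊕ q √ s) = _ ℚᵘ.≤? _

≰ˢ⇒ˢ< : ∀ a x → ¬ a ≤ˢ x → x ˢ< a
≰ˢ⇒ˢ< a (p ⊕ q √ s) = ℚᵘ.≰⇒>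

IsFloor : ℤ → Surd → Set
IsFloor a x = a ≤ˢ x × x ˢ< ℤ.suc a

-- The last of a, a + 1, …, a + k reached while staying ≤ x.
climb : Surd → ℤ → ℕ → ℤ
climb x a zero = a
climb x a (suc k) with ℤ.suc a ≤ˢ? x
... | yes _ = climb x (ℤ.suc a) k
... | no  _ = a

-- One less than an integer bound for ∣ p + q √s ∣.
bound : Surd → ℕ
bound (p ⊕ q √ s) = ℤ.∣ ↥ p ∣ ℕ.+ ℤ.∣ ↥ (signedSquare q ℚᵘ.* s) ∣

⌊_⌋ : Surd → ℤ
⌊ x ⌋ = climb x (ℤ.- + suc (bound x)) (bound x ℕ.+ suc (bound x))

climb-isFloor : ∀ x a k → a ≤ˢ x → x ˢ< + suc k ℤ.+ a → IsFloor (climb x a k) x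
climb-isFloor x a zero lo hi = lo , hi
climb-isFloor x a (suc k) lo hi with ℤ.suc a ≤ˢ? x
... | yes lo′ = climb-isFloor x (ℤ.suc a) k lo′ (subst (x ˢ<_) shift hi)
  where
  shift : + suc (suc k) ℤ.+ a ≡ + suc k ℤ.+ ℤ.suc a
  shift = trans (cong (λ l → + l ℤ.+ a) (ℕ.+-comm 1 (suc k))) (ℤ.+-assoc (+ suc k) 1ℤ a)
... | no ¬lo′ = lo , ≰ˢ⇒ˢ< (ℤ.suc a) x ¬lo′

private
  p≤∣p∣ : ∀ p → p ℚᵘ.≤ ℚᵘ.∣ p ∣
  p≤∣p∣ (mkℚᵘ (+ n)       d) = ℚᵘ.≤-refl
  p≤∣p∣ (mkℚᵘ ℤ.-[1+ n ]  d) = *≤* ℤ.-≤+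

  ∣p∣≤∣↥p∣ : ∀ p → ℚᵘ.∣ p ∣ ℚᵘ.≤ (+ ℤ.∣ ↥ p ∣) ℚᵘ./ 1
  ∣p∣≤∣↥p∣ (mkℚᵘ n d) = *≤* (ℤ.*-monoˡ-≤-nonNeg (+ ℤ.∣ n ∣) (ℤ.+≤+ (ℕ.s≤s ℕ.z≤n)))

  signedSquare-large : ∀ {t c} → 1ℚᵘ ℚᵘ.+ ℚᵘ.∣ c ∣ ℚᵘ.≤ t → c ℚᵘ.< signedSquare t
  signedSquare-large {t} {c} 1+∣c∣≤t = begin-strict
    c                  ≤⟨ p≤∣p∣ c ⟩
    ℚᵘ.∣ c ∣           ≃⟨ ℚᵘ.+-identityˡ ℚᵘ.∣ c ∣ ⟨
    0ℚᵘ ℚᵘ.+ ℚᵘ.∣ c ∣  <⟨ ℚᵘ.+-monoˡ-< ℚᵘ.∣ c ∣ {0ℚᵘ} {1ℚᵘ} (ℚᵘ.*<* (ℤ.+<+ (ℕ.s≤s ℕ.z≤n))) ⟩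
    1ℚᵘ ℚᵘ.+ ℚᵘ.∣ c ∣  ≤⟨ 1+∣c∣≤t ⟩
    t                  ≃⟨ ℚᵘ.*-identityˡ t ⟨
    1ℚᵘ ℚᵘ.* t         ≤⟨ ℚᵘ.*-monoˡ-≤-nonNeg t {{nonNegative 0≤t}} 1≤t ⟩
    t ℚᵘ.* t           ≡⟨ cong (t ℚᵘ.*_) (ℚᵘ.0≤p⇒∣p∣≡p 0≤t) ⟨
    t ℚᵘ.* ℚᵘ.∣ t ∣    ∎
    where
    open ℚᵘ.≤-Reasoning
    1≤t : 1ℚᵘ ℚᵘ.≤ t
    1≤t = ℚᵘ.≤-trans (ℚᵘ.p≤p+q 1ℚᵘ ℚᵘ.∣ c ∣ {{ℚᵘ.∣-∣-nonNeg c}}) 1+∣c∣≤t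
    0≤t : 0ℚᵘ ℚᵘ.≤ t
    0≤t = ℚᵘ.≤-trans (*≤* (ℤ.+≤+ ℕ.z≤n)) 1≤t

  signedSquare-small : ∀ {t c} → 1ℚᵘ ℚᵘ.+ ℚᵘ.∣ c ∣ ℚᵘ.≤ ℚᵘ.- t → signedSquare t ℚᵘ.≤ c
  signedSquare-small {t} {c} 1+∣c∣≤-t = ℚᵘ.neg-cancel-≤ (begin
    ℚᵘ.- c                          ≤⟨ ℚᵘ.<⇒≤ (signedSquare-large (subst (λ u → 1ℚᵘ ℚᵘ.+ u ℚᵘ.≤ ℚᵘ.- t) (sym (ℚᵘ.∣-p∣≡∣p∣ c)) 1+∣c∣≤-t)) ⟩
    ℚᵘ.- t ℚᵘ.* ℚᵘ.∣ ℚᵘ.- t ∣       ≡⟨ cong (ℚᵘ.- t ℚᵘ.*_) (ℚᵘ.∣-p∣≡∣p∣ t) ⟩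
    ℚᵘ.- t ℚᵘ.* ℚᵘ.∣ t ∣            ≃⟨ ℚᵘ.neg-distribˡ-* t ℚᵘ.∣ t ∣ ⟨
    ℚᵘ.- (t ℚᵘ.* ℚᵘ.∣ t ∣)          ∎)
    where open ℚᵘ.≤-Reasoning

  bound-large : ∀ P r c → ℚᵘ.∣ r ∣ ℚᵘ.≤ (+ P) ℚᵘ./ 1 →
                1ℚᵘ ℚᵘ.+ ℚᵘ.∣ c ∣ ℚᵘ.≤ (+ suc (P ℕ.+ ℤ.∣ ↥ c ∣)) ℚᵘ./ 1 ℚᵘ.+ r
  bound-large P r c ∣r∣≤P = begin
    1ℚᵘ ℚᵘ.+ ℚᵘ.∣ c ∣                                       ≤⟨ ℚᵘ.+-monoʳ-≤ 1ℚᵘ (∣p∣≤∣↥p∣ c) ⟩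
    1ℚᵘ ℚᵘ.+ (+ C) ℚᵘ./ 1                                   ≃⟨ ℚᵘ.*≡* (cong (λ z → z ℤ.* + 1) cancel) ⟩
    (+ suc (P ℕ.+ C)) ℚᵘ./ 1 ℚᵘ.+ ℚᵘ.- ((+ P) ℚᵘ./ 1)       ≤⟨ ℚᵘ.+-monoʳ-≤ ((+ suc (P ℕ.+ C)) ℚᵘ./ 1) -P≤r ⟩
    (+ suc (P ℕ.+ C)) ℚᵘ./ 1 ℚᵘ.+ r                         ∎
    where
    open ℚᵘ.≤-Reasoning
    C = ℤ.∣ ↥ c ∣
    -P≤r : ℚᵘ.- ((+ P) ℚᵘ./ 1) ℚᵘ.≤ r
    -P≤r = ℚᵘ.neg-cancel-≤ (begin
      ℚᵘ.- r                          ≤⟨ p≤∣p∣ (ℚᵘ.- r) ⟩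
      ℚᵘ.∣ ℚᵘ.- r ∣                   ≡⟨ ℚᵘ.∣-p∣≡∣p∣ r ⟩
      ℚᵘ.∣ r ∣                        ≤⟨ ∣r∣≤P ⟩
      (+ P) ℚᵘ./ 1                    ≡⟨ ℚᵘ.neg-involutive-≡ ((+ P) ℚᵘ./ 1) ⟨
      ℚᵘ.- ℚᵘ.- ((+ P) ℚᵘ./ 1)        ∎)
    cancel : + 1 ℤ.* + 1 ℤ.+ + C ℤ.* + 1 ≡ + suc (P ℕ.+ C) ℤ.* + 1 ℤ.+ (ℤ.- + P) ℤ.* + 1
    cancel = solve 2 (λ p c → con (+ 1) :* con (+ 1) :+ c :* con (+ 1) :=
                              (con (+ 1) :+ (p :+ c)) :* con (+ 1) :+ (:- p) :* con (+ 1))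
                   refl (+ P) (+ C)
      where open +-*-Solver

⌊⌋-isFloor : ∀ x → IsFloor ⌊ x ⌋ x
⌊⌋-isFloor x@(p ⊕ q √ s) = climb-isFloor x (ℤ.- + suc B) (B ℕ.+ suc B) lower upper
  where
  B = bound x
  c = signedSquare q ℚᵘ.* s

  lower : (ℤ.- + suc B) ≤ˢ x
  lower = signedSquare-small
    (subst (1ℚᵘ ℚᵘ.+ ℚᵘ.∣ c ∣ ℚᵘ.≤_)
      (sym (trans (ℚᵘ.neg-distrib-+ ((ℤ.- + suc B) ℚᵘ./ 1) (ℚᵘ.- p))
                  (cong ((+ suc B) ℚᵘ./ 1 ℚᵘ.+_) (ℚᵘ.neg-involutive-≡ p))))
      (bound-large ℤ.∣ ↥ p ∣ p c (∣p∣≤∣↥p∣ p)))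

  top : + suc (B ℕ.+ suc B) ℤ.+ (ℤ.- + suc B) ≡ + suc B
  top = solve 1 (λ b → (b :+ b) :+ (:- b) := b) refl (+ suc B)
    where open +-*-Solver

  upper : x ˢ< + suc (B ℕ.+ suc B) ℤ.+ (ℤ.- + suc B)
  upper = subst (x ˢ<_) (sym top)
    (signedSquare-large (bound-large ℤ.∣ ↥ p ∣ (ℚᵘ.- p) c
      (subst (ℚᵘ._≤ (+ ℤ.∣ ↥ p ∣) ℚᵘ./ 1) (sym (ℚᵘ.∣-p∣≡∣p∣ p)) (∣p∣≤∣↥p∣ p))))

------------------------------------------------------------------------
-- The game

data Colour : Set where
  black white : Colour

data Cell : Set where
  checker : Colour → Cell
  O       : Cell

b w : Cell
b = checker black
w = checker white

-- The head of the list is position 1.  Only configurations reachable from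
-- initial n m matter below; moves preserve the length and the number of
-- vacancies, so all of them have n + m + 1 positions and a single O.
Configuration : Set
Configuration = List Cell

initial final : ℕ → ℕ → Configuration
initial n m = replicate n b ++ O ∷ replicate m w
final   n m = replicate m w ++ O ∷ replicate n b

-- Move c x c′: in c the checker at position x can legally move into the
-- vacancy, and this results in c′.
data Move : Configuration → ℤ → Configuration → Set where
  slideʳ : ∀ us k vs →
    Move (us ++ checker k ∷ O ∷ vs) (+ (length us ℕ.+ 1)) (us ++ O ∷ checker k ∷ vs)
  slideˡ : ∀ us k vs →
    Move (us ++ O ∷ checker k ∷ vs) (+ (length us ℕ.+ 2)) (us ++ checker k ∷ O ∷ vs)
  jumpʳ  : ∀ us k l vs →
    Move (us ++ checker k ∷ checker l ∷ O ∷ vs) (+ (length us ℕ.+ 1))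
         (us ++ O ∷ checker l ∷ checker k ∷ vs)
  jumpˡ  : ∀ us k l vs →
    Move (us ++ O ∷ checker l ∷ checker k ∷ vs) (+ (length us ℕ.+ 3))
         (us ++ checker k ∷ checker l ∷ O ∷ vs)

data Play : Configuration → List ℤ → Configuration → Set where
  []  : ∀ {c} → Play c [] c
  _∷_ : ∀ {c c′ c″ x xs} → Move c x c′ → Play c′ xs c″ → Play c (x ∷ xs) c″

IsOptimal : Configuration → List ℤ → Configuration → Set
IsOptimal c xs c′ = Play c xs c′ × (∀ ys → Play c ys c′ → length xs ℕ.≤ length ys)

------------------------------------------------------------------------
-- The move sequence

numberOfMoves : ℕ → ℕ → ℕ
numberOfMoves n m = n ℕ.* m ℕ.+ n ℕ.+ m

-- (-1)^k depends only on the parity of k, hence only on ∣k∣.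
infix 8 [-1]^_
[-1]^_ : ℤ → ℤ
[-1]^ k = -1ℤ ℤ.^ ℤ.∣ k ∣

module Sequence (n m : ℕ) (d : ℤ) where
  open import Data.Integer using (_+_; _-_; _*_)

  -- m (m + 3) is even; for m ≤ n the truncated subtraction is exact.
  s₁ s₂ : ℕ
  s₁ = (m ℕ.* (m ℕ.+ 3)) ℕ./ 2
  s₂ = (n ℕ.∸ m) ℕ.* (m ℕ.+ 1)

  -- (√(8i + 1) - 1) / 2 = -1/2 + (1/2) √(8i + 1)
  α : ℕ → ℤ
  α i = ⌊ -½ ⊕ ½ √ ((+ (8 ℕ.* i ℕ.+ 1)) ℚᵘ./ 1) ⌋

  first : ℕ → ℤ
  first i = + n + + 1 - [-1]^ α i * d * (+ 2 * + i - α i * (α i + + 2))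

  β : ℕ → ℤ
  β i = (+ i - + s₁ + + m) ℤ./ (+ suc m)

  p : ℕ → ℤ
  p i = + i - + s₁ - (β i - + 1) * (+ m + + 1)

  -- The argument x[s₁] is the value of the sequence at s₁.
  second : (x[s₁] : ℤ) → ℕ → ℤ
  second x[s₁] i =
    x[s₁] - β i - [-1]^ (+ m + β i) * d * (+ 2 * p i - + 2 - + m * (+ 1 + [-1]^ β i))

  γ : ℕ → ℤ
  γ i = ⌊ ((+ m) ℚᵘ./ 1 ℚᵘ.+ (+ 3) ℚᵘ./ 2) ⊕ (ℚᵘ.- 1ℚᵘ) √
          ((+ m * (+ m + + 1) - + 2 * (+ i - + s₁ - + s₂)) ℚᵘ./ 1 ℚᵘ.+ (+ 9) ℚᵘ./ 4) ⌋

  -- γ (γ - 1) is even, so the integer division is exact.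
  q : ℕ → ℤ
  q i = + i - + s₁ - + s₂ - (γ i - + 1) * (+ m + + 1) + (γ i * (γ i - + 1)) ℤ./ + 2

  -- The argument x[s₁+s₂] is the value of the sequence at s₁ + s₂.
  third : (x[s₁+s₂] : ℤ) → ℕ → ℤ
  third x[s₁+s₂] i =
    x[s₁+s₂] - d * ([-1]^ (+ n + γ i) * (γ i + + 2 * q i - + m - + 2) - + m * [-1]^ (+ n))

  -- The sequence up to index s₁ + s₂; this range is { 1, …, s₁ } when n = m.
  x₁₂ : ℕ → ℤ
  x₁₂ i = if i ≤ᵇ s₁ then first i else second (first s₁) i

  x : ℕ → ℤ
  x i = if i ≤ᵇ s₁ ℕ.+ s₂ then x₁₂ i else third (x₁₂ (s₁ ℕ.+ s₂)) i

open Sequence public using (x)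

-- x₁, …, x_N
moves : ℕ → ℕ → ℤ → List ℤ
moves n m d = applyUpTo (λ i → x n m d (suc i)) (numberOfMoves n m)

{-# OPTIONS --safe #-}
module Submission where

open import Data.Bool using (if_then_else_; true; false; T)
import Data.Integer as ℤ
import Data.Integer.DivMod as ℤ
import Data.Integer.Properties as ℤ
import Data.Integer.Tactic.RingSolver as ℤ-Solver
open import Data.Integer using (ℤ; +_; 1ℤ; -1ℤ; _-_)
open import Data.List using (List; []; _∷_; _++_; _ʳ++_; length; map; reverse; replicate; applyUpTo)
open import Data.List.Membership.Propositional using (_∈_)
open import Data.List.Membership.Propositional.Properties using (∈-++⁺ʳ)
open import Data.List.Properties
  using (length-++; length-replicate; length-reverse; length-applyUpTo; ++-assoc; ++-identityʳ; ʳ++-defn;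
         map-++; map-replicate; map-injective; ∷-injective; ∷-injectiveʳ)
open import Data.List.Relation.Unary.Any using (here; there)
open import Data.Nat hiding (parity)
open import Data.Nat.DivMod using (+-distrib-/-∣ʳ; m*n/n≡m; m<n⇒m/n≡0)
open import Data.Nat.Divisibility using (divides-refl)
open import Data.Nat.Properties
open import Data.Nat.Tactic.RingSolver using (solve-∀)
open import Data.Product using (_×_; _,_; ∃₂; proj₁; proj₂)
open import Data.Rational.Unnormalised as ℚᵘ using (mkℚᵘ; *≤*; *<*; ½; -½; 1ℚᵘ)
import Data.Rational.Unnormalised.Properties as ℚᵘ
open import Data.Sum using (_⊎_; inj₁; inj₂)
open import Data.Unit using (tt)
open import Function using (_∘_)
open import Relation.Binary.PropositionalEquality
open import Relation.Nullary using (¬_; contradiction)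
open import Defs

-- The sequence consists of n + m sweeps of the vacancy, alternately to the
-- left and to the right.  A sweep is one slide followed by a jumps; if it is
-- the k-th sweep, its moves are x = c - (-1)^k d (2j - a) for j = 0, …, a, with
--   k = α,      c = n + 1,      a = α       (1 ≤ α ≤ m),
--   k = m + β,  c = n + 1 - β,  a = m       (1 ≤ β ≤ n - m),
--   k = n + γ,  c = m + 1,      a = m - γ   (1 ≤ γ ≤ m).
-- After each sweep the vacancy is at one end of an alternating block (wb)^a;
-- the slide turns this block into one of the form (bw)^a, and the jumps turn
-- it into (wb)^a again while the vacancy passes to its other end.
--
-- Optimality: only jumps over the other colour change the number of
-- inversions (a b left of a w), by one each, so n m of them are needed.
-- Consider the n + m - 1 exchanges of the first w with every b and then of the
-- first b with every other w.  They happen in this order and the place of an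
-- exchange changes parity from each to the next; since only slides change the
-- parity of the place of the vacancy, there is a slide between any two of them
-- in succession, one before the first and one after the last.

-- A potential that each move lowers by at most one

whites : List Colour → ℕ
whites []          = 0
whites (black ∷ u) = whites u
whites (white ∷ u) = suc (whites u)

inversions : List Colour → ℕ
inversions []          = 0
inversions (black ∷ u) = whites u + inversions u
inversions (white ∷ u) = inversions u

leading : Colour → List Colour → ℕ
leading black (black ∷ u) = suc (leading black u)
leading white (white ∷ u) = suc (leading white u)
leading _     _           = 0

mod2 : ℕ → ℕ
mod2 0             = 0
mod2 1             = 1
mod2 (suc (suc k)) = mod2 k

-- The largest number ≤ h congruent to v modulo 2 (and 0 if there is none).
align : ℕ → ℕ → ℕ
align h v = h ∸ mod2 (h + v)

-- The slides still needed: the remaining ones of the n + m - 1 exchanges, one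
-- more if the vacancy has the wrong parity for the next of them.  v is the
-- number of checkers to the left of the vacancy.  If u is nonempty, one of the
-- two leading runs is empty.
slides : ℕ → ℕ → List Colour → ℕ
slides m v u = (m + align (leading black u) v) ∸ align (leading white u) v

potential : ℕ → List Colour → List Colour → ℕ
potential m l r = inversions (l ++ r) + slides m (length l) (l ++ r)

mod2≤1 : ∀ k → mod2 k ≤ 1
mod2≤1 0             = z≤n
mod2≤1 1             = s≤s z≤n
mod2≤1 (suc (suc k)) = mod2≤1 k

mod2-double : ∀ k → mod2 (k + k) ≡ 0
mod2-double zero = refl
mod2-double (suc k) rewrite +-suc k k = mod2-double k

mod2-suc-double : ∀ k → mod2 (suc k + k) ≡ 1
mod2-suc-double zero = refl
mod2-suc-double (suc k) rewrite +-suc k k = mod2-suc-double k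

-- Whatever its second argument, `align h` lies between `h ∸ 1` and `h`.
align≤suc : ∀ h v v′ → align h v ≤ suc (align h v′)
align≤suc h v v′ = begin
  h ∸ mod2 (h + v)          ≤⟨ m∸n≤m h (mod2 (h + v)) ⟩
  h                           ≤⟨ m≤n+m∸n h 1 ⟩
  suc (h ∸ 1)                 ≤⟨ s≤s (∸-monoʳ-≤ h (mod2≤1 (h + v′))) ⟩
  suc (h ∸ mod2 (h + v′))   ∎
  where open ≤-Reasoning

align-0 : ∀ v → align 0 v ≡ 0
align-0 v = 0∸n≡0 (mod2 v)

align-period : ∀ h v → align h (2 + v) ≡ align h v
align-period h v rewrite +-suc h (suc v) | +-suc h v = refl

-- The first colour of the word makes one of the two leading runs empty, and an empty run aligns to
-- 0 for every vacancy. Hence only one of the two `align` terms depends on the vacancy, and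
-- `align≤suc` bounds its change.
slides-step : ∀ m u v v′ → slides m v u ≤ suc (slides m v′ u)
slides-step m [] v v′ rewrite align-0 v | align-0 v′ = n≤1+n (m + 0)
slides-step m (black ∷ u) v v′ rewrite align-0 v | align-0 v′ | sym (+-suc m (align (suc (leading black u)) v′)) =
  +-monoʳ-≤ m (align≤suc (suc (leading black u)) v v′)
slides-step m (white ∷ u) v v′ rewrite align-0 v | align-0 v′ = begin
  (m + 0) ∸ align h v            ≤⟨ m≤n+m∸n ((m + 0) ∸ align h v) 1 ⟩
  suc (((m + 0) ∸ align h v) ∸ 1) ≡⟨ cong suc (∸-+-assoc (m + 0) (align h v) 1) ⟩
  suc ((m + 0) ∸ (align h v + 1)) ≤⟨ s≤s (∸-monoʳ-≤ (m + 0) (≤-trans (align≤suc h v′ v) (≤-reflexive (+-comm 1 _)))) ⟩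
  suc ((m + 0) ∸ align h v′)     ∎
  where
  open ≤-Reasoning
  h = suc (leading white u)

slides-period : ∀ m v u → slides m (2 + v) u ≡ slides m v u
slides-period m v u = cong₂ (λ s t → (m + s) ∸ t) (align-period (leading black u) v) (align-period (leading white u) v)

Near : ℕ → ℕ → Set
Near j h = h ≡ j ⊎ h ≡ suc j

-- A run of length `j` has the parity of the vacancy; a run of length `suc j` has the other one and
-- is rounded down.
align-near : ∀ {j h} → Near j h → align h j ≡ j
align-near {j} (inj₁ refl) rewrite mod2-double j = refl
align-near {j} (inj₂ refl) rewrite mod2-suc-double j = refl

near-suc : ∀ {j h} → Near j h → Near (suc j) (suc h)
near-suc (inj₁ p) = inj₁ (cong suc p)
near-suc (inj₂ p) = inj₂ (cong suc p)

-- A run that ends inside `us` is unaffected, and so is every run if the two letters agree.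
-- Otherwise the run covers `us` and exactly one of the two letters has colour `c`: it prolongs the
-- run by one if it comes first and not at all if it comes second.
leading-swap : ∀ c k l us vs →
  leading c (us ++ k ∷ l ∷ vs) ≡ leading c (us ++ l ∷ k ∷ vs) ⊎
  Near (length us) (leading c (us ++ k ∷ l ∷ vs)) × Near (length us) (leading c (us ++ l ∷ k ∷ vs))
leading-swap _     black black []           vs = inj₁ refl
leading-swap _     white white []           vs = inj₁ refl
leading-swap black black white []           vs = inj₂ (inj₂ refl , inj₁ refl)
leading-swap black white black []           vs = inj₂ (inj₁ refl , inj₂ refl)
leading-swap white black white []           vs = inj₂ (inj₁ refl , inj₂ refl)
leading-swap white white black []           vs = inj₂ (inj₂ refl , inj₁ refl)
leading-swap black _     _     (white ∷ us) vs = inj₁ refl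
leading-swap white _     _     (black ∷ us) vs = inj₁ refl
leading-swap black k     l     (black ∷ us) vs with leading-swap black k l us vs
... | inj₁ p       = inj₁ (cong suc p)
... | inj₂ (p , q) = inj₂ (near-suc p , near-suc q)
leading-swap white k     l     (white ∷ us) vs with leading-swap white k l us vs
... | inj₁ p       = inj₁ (cong suc p)
... | inj₂ (p , q) = inj₂ (near-suc p , near-suc q)

align-swap : ∀ c k l us vs →
  align (leading c (us ++ k ∷ l ∷ vs)) (length us) ≡ align (leading c (us ++ l ∷ k ∷ vs)) (length us)
align-swap c k l us vs with leading-swap c k l us vs
... | inj₁ p       = cong (λ h → align h (length us)) p
... | inj₂ (p , q) = trans (align-near p) (sym (align-near q))

-- A jump changes the length of a leading run only between length us and
-- length us + 1, and align does not distinguish these.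
slides-swap : ∀ m k l us vs → slides m (length us) (us ++ k ∷ l ∷ vs) ≡ slides m (length us) (us ++ l ∷ k ∷ vs)
slides-swap m k l us vs = cong₂ (λ s t → (m + s) ∸ t) (align-swap black k l us vs) (align-swap white k l us vs)

whites-swap : ∀ k l us vs → whites (us ++ k ∷ l ∷ vs) ≡ whites (us ++ l ∷ k ∷ vs)
whites-swap black black []           vs = refl
whites-swap black white []           vs = refl
whites-swap white black []           vs = refl
whites-swap white white []           vs = refl
whites-swap k     l     (black ∷ us) vs = whites-swap k l us vs
whites-swap k     l     (white ∷ us) vs = cong suc (whites-swap k l us vs)

-- By `whites-swap`, letters of `us` see equally many w to their right before and after, so only the
-- exchanged pair counts. Turning bw into wb removes one inversion; no other exchange removes any.
inversions-swap : ∀ k l us vs → inversions (us ++ k ∷ l ∷ vs) ≤ suc (inversions (us ++ l ∷ k ∷ vs))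
inversions-swap black black []           vs = n≤1+n _
inversions-swap black white []           vs = ≤-refl
inversions-swap white black []           vs = ≤-trans (n≤1+n _) (n≤1+n _)
inversions-swap white white []           vs = n≤1+n _
inversions-swap k     l     (white ∷ us) vs = inversions-swap k l us vs
inversions-swap k     l     (black ∷ us) vs
  rewrite whites-swap k l us vs | sym (+-suc (whites (us ++ l ∷ k ∷ vs)) (inversions (us ++ l ∷ k ∷ vs))) =
  +-monoʳ-≤ (whites (us ++ l ∷ k ∷ vs)) (inversions-swap k l us vs)

-- Configurations as pairs of colour words, and the effect of a move on the potential

position : List Colour → List Colour → Configuration
position l r = map checker l ++ O ∷ map checker r

O∉checkers : ∀ u → ¬ O ∈ map checker u
O∉checkers (_ ∷ u) (there p) = O∉checkers u p

-- This locates the vacancy of a `Move`, given inside the tail `zs`, relative to the words `l` and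
-- `r`. If `l` were used up within `us`, the vacancy in `zs` would be among the checkers of `r`.
position-split : ∀ us {zs} l r → O ∈ zs → us ++ zs ≡ position l r →
  ∃₂ λ l₁ l₂ → us ≡ map checker l₁ × zs ≡ position l₂ r × l ≡ l₁ ++ l₂
position-split []       l       r O∈zs eq = [] , l , refl , eq , refl
position-split (_ ∷ us) []      r O∈zs eq =
  contradiction (subst (O ∈_) (∷-injectiveʳ eq) (∈-++⁺ʳ us O∈zs)) (O∉checkers r)
position-split (_ ∷ us) (k ∷ l) r O∈zs eq with ∷-injective eq
... | refl , eq′ with position-split us l r O∈zs eq′
... | l₁ , l₂ , refl , p , refl = k ∷ l₁ , l₂ , refl , p , refl

-- A slide leaves the word `l ++ r` alone, so only the `slides` term can change, by at most one. The
-- two inequalities serve the two directions.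
potential-slide : ∀ m k l r →
  potential m (l ++ k ∷ []) r ≤ suc (potential m l (k ∷ r)) ×
  potential m l (k ∷ r) ≤ suc (potential m (l ++ k ∷ []) r)
potential-slide m k l r rewrite ++-assoc l (k ∷ []) r
                              | sym (+-suc (inversions (l ++ k ∷ r)) (slides m (length l) (l ++ k ∷ r)))
                              | sym (+-suc (inversions (l ++ k ∷ r)) (slides m (length (l ++ k ∷ [])) (l ++ k ∷ r))) =
  step (length (l ++ k ∷ [])) (length l) , step (length l) (length (l ++ k ∷ []))
  where
  step : ∀ v v′ → inversions (l ++ k ∷ r) + slides m v (l ++ k ∷ r) ≤
                  inversions (l ++ k ∷ r) + suc (slides m v′ (l ++ k ∷ r))
  step v v′ = +-monoʳ-≤ (inversions (l ++ k ∷ r)) (slides-step m (l ++ k ∷ r) v v′)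

-- A jump moves the vacancy by two places, which `align` does not see, and exchanges two letters
-- right at the vacancy, where `slides-swap` applies. Only the inversions can change.
potential-jump : ∀ m k k′ l r →
  potential m (l ++ k ∷ k′ ∷ []) r ≤ suc (potential m l (k′ ∷ k ∷ r)) ×
  potential m l (k ∷ k′ ∷ r) ≤ suc (potential m (l ++ k′ ∷ k ∷ []) r)
potential-jump m k k′ l r
  rewrite ++-assoc l (k ∷ k′ ∷ []) r | ++-assoc l (k′ ∷ k ∷ []) r
        | length-++ l {k ∷ k′ ∷ []} | length-++ l {k′ ∷ k ∷ []} | +-comm (length l) 2
        | slides-period m (length l) (l ++ k ∷ k′ ∷ r) | slides-period m (length l) (l ++ k′ ∷ k ∷ r)
        | slides-swap m k k′ l r =
  swapped , swapped
  where swapped = +-monoˡ-≤ (slides m (length l) (l ++ k′ ∷ k ∷ r)) (inversions-swap k k′ l r)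

rebracket : ∀ l₁ l₂ r → map checker l₁ ++ map checker l₂ ++ O ∷ map checker r ≡ position (l₁ ++ l₂) r
rebracket l₁ l₂ r = trans (sym (++-assoc (map checker l₁) _ _)) (cong (_++ O ∷ map checker r) (sym (map-++ checker l₁ l₂)))

potential-move : ∀ m {c x c′} l r → Move c x c′ → c ≡ position l r →
  ∃₂ λ l′ r′ → c′ ≡ position l′ r′ × potential m l r ≤ suc (potential m l′ r′)
potential-move m l r (slideʳ us k vs) eq with position-split us l r (there (here refl)) eq
-- The vacancy is the second cell of the tail, which forces the second part of `l` to be a single
-- checker.
... | l₁ , _ ∷ [] , refl , refl , refl =
  l₁ , k ∷ r , refl , proj₁ (potential-slide m k l₁ r)
potential-move m l r (slideˡ us k vs) eq with position-split us l r (here refl) eq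
potential-move m l (k ∷ r) (slideˡ _ k _) _ | l₁ , [] , refl , refl , refl =
  l₁ ++ k ∷ [] , r , rebracket l₁ (k ∷ []) r ,
  subst (λ l → potential m l (k ∷ r) ≤ suc (potential m (l₁ ++ k ∷ []) r)) (sym (++-identityʳ l₁))
    (proj₂ (potential-slide m k l₁ r))
potential-move m l r (jumpʳ us k k′ vs) eq with position-split us l r (there (there (here refl))) eq
... | l₁ , _ ∷ _ ∷ [] , refl , refl , refl =
  l₁ , k′ ∷ k ∷ r , refl , proj₁ (potential-jump m k k′ l₁ r)
potential-move m l r (jumpˡ us k k′ vs) eq with position-split us l r (here refl) eq
potential-move m l (k′ ∷ k ∷ r) (jumpˡ _ k k′ _) _ | l₁ , [] , refl , refl , refl =
  l₁ ++ k ∷ k′ ∷ [] , r , rebracket l₁ (k ∷ k′ ∷ []) r ,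
  subst (λ l → potential m l (k′ ∷ k ∷ r) ≤ suc (potential m (l₁ ++ k ∷ k′ ∷ []) r)) (sym (++-identityʳ l₁))
    (proj₂ (potential-jump m k′ k l₁ r))

potential-play : ∀ m {c xs c′} l r → Play c xs c′ → c ≡ position l r →
  ∃₂ λ l′ r′ → c′ ≡ position l′ r′ × potential m l r ≤ length xs + potential m l′ r′
potential-play m l r [] eq = l , r , eq , ≤-refl
potential-play m l r (move ∷ play) eq
  with l₁ , r₁ , eq₁ , le₁ ← potential-move m l r move eq
  with l₂ , r₂ , eq₂ , le₂ ← potential-play m l₁ r₁ play eq₁ =
  l₂ , r₂ , eq₂ , ≤-trans le₁ (s≤s le₂)

position-replicate : ∀ j k l r → replicate j (checker k) ++ O ∷ replicate l (checker r) ≡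
                                 position (replicate j k) (replicate l r)
position-replicate j k l r = sym (cong₂ (λ us vs → us ++ O ∷ vs) (map-replicate checker j k) (map-replicate checker l r))

position-injective : ∀ l₁ r₁ l₂ r₂ → position l₁ r₁ ≡ position l₂ r₂ → l₁ ≡ l₂ × r₁ ≡ r₂
position-injective []       r₁ []       r₂ eq = refl , map-injective (λ { refl → refl }) (∷-injectiveʳ eq)
position-injective []       r₁ (_ ∷ l₂) r₂ ()
position-injective (_ ∷ l₁) r₁ []       r₂ ()
position-injective (_ ∷ l₁) r₁ (_ ∷ l₂) r₂ eq with ∷-injective eq
... | refl , eq′ with position-injective l₁ r₁ l₂ r₂ eq′
... | refl , refl = refl , refl

-- The potential at both ends of the game, and the lower bound

whites-replicate : ∀ m → whites (replicate m white) ≡ m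
whites-replicate zero    = refl
whites-replicate (suc m) = cong suc (whites-replicate m)

inversions-replicate : ∀ m → inversions (replicate m white) ≡ 0
inversions-replicate zero    = refl
inversions-replicate (suc m) = inversions-replicate m

whites-initial : ∀ n m → whites (replicate n black ++ replicate m white) ≡ m
whites-initial zero    m = whites-replicate m
whites-initial (suc n) m = whites-initial n m

inversions-initial : ∀ n m → inversions (replicate n black ++ replicate m white) ≡ n * m
inversions-initial zero    m = inversions-replicate m
inversions-initial (suc n) m = cong₂ _+_ (whites-initial n m) (inversions-initial n m)

whites-black : ∀ n → whites (replicate n black) ≡ 0
whites-black zero    = refl
whites-black (suc n) = whites-black n

inversions-final : ∀ m n → inversions (replicate m white ++ replicate n black) ≡ 0
inversions-final zero    zero    = refl
inversions-final zero    (suc n) = cong₂ _+_ (whites-black n) (inversions-final zero n)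
inversions-final (suc m) n       = inversions-final m n

leading-black : ∀ j l → leading black (replicate j black ++ replicate l white) ≡ j
leading-black zero    zero    = refl
leading-black zero    (suc l) = refl
leading-black (suc j) l       = cong suc (leading-black j l)

leading-white : ∀ j l → leading white (replicate j white ++ replicate l black) ≡ j
leading-white zero    zero    = refl
leading-white zero    (suc l) = refl
leading-white (suc j) l       = cong suc (leading-white j l)

align-self : ∀ j → align j j ≡ j
align-self j = align-near (inj₁ refl)

-- As `n` is positive, the word begins with b and its leading white run is empty. The black run has
-- length `n`, which is also the place of the vacancy, so alignment costs nothing and all `m + n`
-- slides are outstanding.
potential-initial : ∀ n m → 1 ≤ n → potential m (replicate n black) (replicate m white) ≡ n * m + n + m
potential-initial n@(suc _) m _ = begin
  inversions u + ((m + align (leading black u) (length l)) ∸ align 0 (length l))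
    ≡⟨ cong₂ _+_ (inversions-initial n m) (cong₂ (λ s t → (m + s) ∸ t) aligned (align-0 (length l))) ⟩
  n * m + (m + n)   ≡⟨ cong (λ k → n * m + k) (+-comm m n) ⟩
  n * m + (n + m)   ≡⟨ +-assoc (n * m) n m ⟨
  n * m + n + m     ∎
  where
  open ≡-Reasoning
  l = replicate n black
  u = l ++ replicate m white
  aligned : align (leading black u) (length l) ≡ n
  aligned = trans (cong₂ align (leading-black n m) (length-replicate n)) (align-self n)

-- As `m` is positive, the leading black run is empty. The white run of length `m` is aligned with
-- the vacancy and cancels the `m` of `slides`.
potential-final : ∀ n m → 1 ≤ m → potential m (replicate m white) (replicate n black) ≡ 0
potential-final n m@(suc _) _ = begin
  inversions u + ((m + align 0 (length l)) ∸ align (leading white u) (length l))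
    ≡⟨ cong₂ _+_ (inversions-final m n) (cong₂ (λ s t → (m + s) ∸ t) (align-0 (length l)) aligned) ⟩
  (m + 0) ∸ m   ≡⟨ cong (_∸ m) (+-identityʳ m) ⟩
  m ∸ m         ≡⟨ n∸n≡0 m ⟩
  0             ∎
  where
  open ≡-Reasoning
  l = replicate m white
  u = l ++ replicate n black
  aligned : align (leading white u) (length l) ≡ m
  aligned = trans (cong₂ align (leading-white m n) (length-replicate m)) (align-self m)

-- The potential has to fall from `n * m + n + m` to 0 by at most one per move. The `position l r`
-- in which the play ends is identified with the final one by injectivity.
play-length≥ : ∀ n m → 1 ≤ n → 1 ≤ m → ∀ ys → Play (initial n m) ys (final n m) → n * m + n + m ≤ length ys
play-length≥ n m 1≤n 1≤m ys play
  with l , r , eq , le ← potential-play m _ _ play (position-replicate n black m white)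
  with refl , refl ← position-injective (replicate m white) (replicate n black) l r
                       (trans (sym (position-replicate m white n black)) eq) = begin
  n * m + n + m                                                        ≡⟨ potential-initial n m 1≤n ⟨
  potential m (replicate n black) (replicate m white)                  ≤⟨ le ⟩
  length ys + potential m (replicate m white) (replicate n black)      ≡⟨ cong (λ k → length ys + k) (potential-final n m 1≤m) ⟩
  length ys + 0                                                        ≡⟨ +-identityʳ _ ⟩
  length ys                                                            ∎
  where open ≤-Reasoning

-- Sweeps of the vacancy

Move-resp : ∀ {c₁ c₂ x₁ x₂ c₁′ c₂′} → c₁ ≡ c₂ → x₁ ≡ x₂ → c₁′ ≡ c₂′ → Move c₁ x₁ c₁′ → Move c₂ x₂ c₂′
Move-resp refl refl refl move = move

Play-target : ∀ {c xs c₁ c₂} → c₁ ≡ c₂ → Play c xs c₁ → Play c xs c₂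
Play-target refl play = play

Play-along : ∀ {c xs ys c′} → xs ≡ ys → Play c xs c′ → Play c ys c′
Play-along refl play = play

Play-++ : ∀ {c c′ c″ xs ys} → Play c xs c′ → Play c′ ys c″ → Play c (xs ++ ys) c″
Play-++ []            play′ = play′
Play-++ (move ∷ play) play′ = move ∷ Play-++ play play′

applyUpTo-+ : ∀ (f : ℕ → ℤ) k l → applyUpTo f (k + l) ≡ applyUpTo f k ++ applyUpTo (λ j → f (k + j)) l
applyUpTo-+ f zero    l = refl
applyUpTo-+ f (suc k) l = cong (f 0 ∷_) (applyUpTo-+ (f ∘ suc) k l)

applyUpTo-cong : ∀ {f g : ℕ → ℤ} → (∀ j → f j ≡ g j) → ∀ k → applyUpTo f k ≡ applyUpTo g k
applyUpTo-cong f≗g zero    = refl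
applyUpTo-cong f≗g (suc k) = cong₂ _∷_ (f≗g 0) (applyUpTo-cong (f≗g ∘ suc) k)

-- A zipper: the left part is read from the vacancy outwards, so that both neighbours of the vacancy
-- are heads of lists.
vacancyAt : List Cell → List Cell → Configuration
vacancyAt us vs = us ʳ++ O ∷ vs

-- The number of a move is the new place of the vacancy, 1 + the length of the new left part.
module _ (us : List Cell) where
  private
    zipper : ∀ {z z′ k} → Move (reverse us ++ z) (+ (length (reverse us) + suc k)) (reverse us ++ z′) →
             Move (us ʳ++ z) (+ suc (k + length us)) (us ʳ++ z′)
    zipper {z} {z′} {k} move rewrite ʳ++-defn us {z} | ʳ++-defn us {z′} =
      subst (λ x → Move (reverse us ++ z) (+ x) (reverse us ++ z′))
        (trans (cong (_+ suc k) (length-reverse us)) (+-comm (length us) (suc k))) move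

  slide← : ∀ k vs → Move (vacancyAt (checker k ∷ us) vs) (+ suc (length us)) (vacancyAt us (checker k ∷ vs))
  slide← k vs = zipper (slideʳ (reverse us) k vs)

  slide→ : ∀ k vs → Move (vacancyAt us (checker k ∷ vs)) (+ suc (suc (length us))) (vacancyAt (checker k ∷ us) vs)
  slide→ k vs = zipper (slideˡ (reverse us) k vs)

  jump← : ∀ k l vs → Move (vacancyAt (checker k ∷ checker l ∷ us) vs) (+ suc (length us))
                          (vacancyAt us (checker k ∷ checker l ∷ vs))
  jump← k l vs = zipper (jumpʳ (reverse us) l k vs)

  jump→ : ∀ k l vs → Move (vacancyAt us (checker k ∷ checker l ∷ vs)) (+ suc (suc (suc (length us))))
                          (vacancyAt (checker k ∷ checker l ∷ us) vs)
  jump→ k l vs = zipper (jumpˡ (reverse us) l k vs)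

-- (p q)^k vs
alt : Colour → Colour → ℕ → List Cell → List Cell
alt p q zero    vs = vs
alt p q (suc k) vs = checker p ∷ checker q ∷ alt p q k vs

-- A slide that starts a sweep makes it necessary to read the block with its phase shifted by one
-- checker.
alt-rotate : ∀ p q k vs → checker p ∷ alt q p k vs ≡ alt p q k (checker p ∷ vs)
alt-rotate p q zero    vs = refl
alt-rotate p q (suc k) vs = cong (λ zs → checker p ∷ checker q ∷ zs) (alt-rotate p q k vs)

alt-suc : ∀ p q k vs → alt p q k (checker p ∷ checker q ∷ vs) ≡ alt p q (suc k) vs
alt-suc p q k vs = trans (sym (alt-rotate p q k _)) (cong (checker p ∷_) (sym (alt-rotate q p k vs)))

length-alt : ∀ p q k vs → length (alt p q k vs) ≡ length vs + 2 * k
length-alt p q zero    vs = sym (+-identityʳ _)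
length-alt p q (suc k) vs = trans (cong (λ h → suc (suc h)) (length-alt p q k vs)) (shift (length vs) k)
  where
  shift : ∀ h k → suc (suc (h + 2 * k)) ≡ h + 2 * suc k
  shift = solve-∀

-- Each jump transfers the pair next to the vacancy from one list of the zipper to the other. As the
-- left list is reversed, the block keeps the description `alt p q`, although in the row (pq)^k has
-- become (qp)^k.
jumps→ : ∀ p q k us vs f → (∀ j → j < k → f j ≡ + suc (length us + 2 * suc j)) →
         Play (vacancyAt us (alt p q k vs)) (applyUpTo f k) (vacancyAt (alt p q k us) vs)
jumps→ p q zero    us vs f f≡ = []
jumps→ p q (suc k) us vs f f≡ =
  Move-resp refl (sym (trans (f≡ 0 z<s) (cong (λ x → + suc x) (+-comm (length us) 2)))) refl (jump→ us p q (alt p q k vs))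
  ∷ Play-target (cong (λ zs → vacancyAt zs vs) (alt-suc p q k us))
      (jumps→ p q k (checker p ∷ checker q ∷ us) vs (f ∘ suc)
        (λ j j<k → trans (f≡ (suc j) (s<s j<k)) (cong (λ x → + suc x) (shift (length us) j))))
  where
  shift : ∀ h j → h + 2 * suc (suc j) ≡ suc (suc (h + 2 * suc j))
  shift = solve-∀

jumps← : ∀ p q k us vs f → (∀ j → j < k → f j ≡ + suc (length us + 2 * (k ∸ suc j))) →
         Play (vacancyAt (alt p q k us) vs) (applyUpTo f k) (vacancyAt us (alt p q k vs))
jumps← p q zero    us vs f f≡ = []
jumps← p q (suc k) us vs f f≡ =
  Move-resp refl (sym (trans (f≡ 0 z<s) (cong (λ x → + suc x) (sym (length-alt p q k us))))) refl (jump← (alt p q k us) p q vs)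
  ∷ Play-target (cong (vacancyAt us) (alt-suc p q k vs))
      (jumps← p q k us (checker p ∷ checker q ∷ vs) (f ∘ suc) (λ j j<k → f≡ (suc j) (s<s j<k)))

-- The three kinds of sweep

data Side : Set where
  left right : Side

flip : Side → Side
flip left  = right
flip right = left

sgn : Side → ℤ
sgn left  = 1ℤ
sgn right = -1ℤ

-- Vacancy at one end of a block (wb)^a; the left part of a zipper is reversed.
state : Side → List Cell → ℕ → List Cell → Configuration
state left  us a vs = vacancyAt us (alt white black a vs)
state right us a vs = vacancyAt (alt black white a us) vs

-- The j-th vacancy of a sweep of amplitude a about centre c towards side s.
path : Side → ℤ → ℕ → ℕ → ℤ
path s c a j = c - sgn s ℤ.* (+ 2 ℤ.* + j - + a)

path-right : ∀ h a j → path right (+ suc (h + a)) a j ≡ + suc (h + 2 * j)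
path-right h a j = trans (ring (+ h) (+ a) (+ j)) (cong (λ z → 1ℤ ℤ.+ (+ h ℤ.+ z)) (sym (ℤ.pos-* 2 j)))
  where
  ring : ∀ h a j → 1ℤ ℤ.+ (h ℤ.+ a) - -1ℤ ℤ.* (+ 2 ℤ.* j - a) ≡ 1ℤ ℤ.+ (h ℤ.+ + 2 ℤ.* j)
  ring = ℤ-Solver.solve-∀

path-left : ∀ h {a j} → j ≤ a → path left (+ suc (h + a)) a j ≡ + suc (h + 2 * (a ∸ j))
path-left h {a} {j} j≤a = begin
  + suc (h + a) - 1ℤ ℤ.* (+ 2 ℤ.* + j - + a)
    ≡⟨ cong (λ z → + suc (h + z) - 1ℤ ℤ.* (+ 2 ℤ.* + j - + z)) (m+[n∸m]≡n j≤a) ⟨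
  + suc (h + (j + k)) - 1ℤ ℤ.* (+ 2 ℤ.* + j - + (j + k))
    ≡⟨ ring (+ h) (+ j) (+ k) ⟩
  1ℤ ℤ.+ (+ h ℤ.+ + 2 ℤ.* + k)
    ≡⟨ cong (λ z → 1ℤ ℤ.+ (+ h ℤ.+ z)) (ℤ.pos-* 2 k) ⟨
  + suc (h + 2 * k) ∎
  where
  open ≡-Reasoning
  k = a ∸ j
  ring : ∀ h j k → 1ℤ ℤ.+ (h ℤ.+ (j ℤ.+ k)) - 1ℤ ℤ.* (+ 2 ℤ.* j - (j ℤ.+ k)) ≡ 1ℤ ℤ.+ (h ℤ.+ + 2 ℤ.* k)
  ring = ℤ-Solver.solve-∀

-- The opening slide is a parameter because the three kinds of sweep differ in it and share the
-- jumps.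
sweepʳ : ∀ a us vs f {c} → Move c (+ suc (length us)) (vacancyAt us (alt black white a vs)) →
         (∀ j → j ≤ a → f j ≡ path right (+ suc (length us + a)) a j) →
         Play c (applyUpTo f (suc a)) (state right us a vs)
sweepʳ a us vs f slide f≡ =
  Move-resp refl (sym (trans (f≡′ 0 z≤n) (cong (λ x → + suc x) (+-identityʳ _)))) refl slide
  ∷ jumps→ black white a us vs (f ∘ suc) (λ j j<a → f≡′ (suc j) j<a)
  where
  f≡′ : ∀ j → j ≤ a → f j ≡ + suc (length us + 2 * j)
  f≡′ j j≤a = trans (f≡ j j≤a) (path-right (length us) a j)

sweepˡ : ∀ a us vs f {c} → Move c (+ suc (length (alt white black a us))) (vacancyAt (alt white black a us) vs) →
         (∀ j → j ≤ a → f j ≡ path left (+ suc (length us + a)) a j) →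
         Play c (applyUpTo f (suc a)) (state left us a vs)
sweepˡ a us vs f slide f≡ =
  Move-resp refl (sym (trans (f≡′ 0 z≤n) (cong (λ x → + suc x) (sym (length-alt white black a us))))) refl slide
  ∷ jumps← white black a us vs (f ∘ suc) (λ j j<a → f≡′ (suc j) j<a)
  where
  f≡′ : ∀ j → j ≤ a → f j ≡ + suc (length us + 2 * (a ∸ j))
  f≡′ j j≤a = trans (f≡ j j≤a) (path-left (length us) j≤a)

-- The block takes in its two outer neighbours, one of them by the slide: b(wb)^a w is (bw)^(a+1),
-- which the jumps turn into (wb)^(a+1).
sweep-grow : ∀ s a us vs f → (∀ j → j ≤ suc a → f j ≡ path (flip s) (+ suc (length us + suc a)) (suc a) j) →
             Play (state s (b ∷ us) a (w ∷ vs)) (applyUpTo f (suc (suc a))) (state (flip s) us (suc a) vs)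
sweep-grow left a us vs f = sweepʳ (suc a) us vs f
  (Move-resp refl refl (cong (vacancyAt us) (trans (alt-rotate black white a (w ∷ vs)) (alt-suc black white a vs)))
    (slide← us black (alt white black a (w ∷ vs))))
sweep-grow right a us vs f = sweepˡ (suc a) us vs f
  (Move-resp refl (cong (λ zs → + suc (length zs)) eq) (cong (λ zs → vacancyAt zs vs) eq)
    (slide→ (alt black white a (b ∷ us)) white vs))
  where
  eq : w ∷ alt black white a (b ∷ us) ≡ alt white black (suc a) us
  eq = trans (alt-rotate white black a (b ∷ us)) (alt-suc white black a us)

-- Since b(wb)^a is (bw)^a b, the slide of a b puts block and vacancy one place further left, with a
-- b left behind on the right.
sweep-shift : ∀ s a us vs f → (∀ j → j ≤ a → f j ≡ path (flip s) (+ suc (length us + a)) a j) →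
              Play (state s (b ∷ us) a vs) (applyUpTo f (suc a)) (state (flip s) us a (b ∷ vs))
sweep-shift left a us vs f = sweepʳ a us (b ∷ vs) f
  (Move-resp refl refl (cong (vacancyAt us) (alt-rotate black white a vs)) (slide← us black (alt white black a vs)))
sweep-shift right a us vs f = sweepˡ a us (b ∷ vs) f
  (Move-resp (cong (λ zs → vacancyAt zs vs) (alt-rotate black white a us)) refl refl (slide← (alt white black a us) black vs))

-- Since (wb)^(a+1) is w(bw)^a b, the outer checkers can be released, w to the left and b to the
-- right, one of them by the slide.
sweep-shrink : ∀ s a us vs f → (∀ j → j ≤ a → f j ≡ path (flip s) (+ suc (suc (length us) + a)) a j) →
               Play (state s us (suc a) vs) (applyUpTo f (suc a)) (state (flip s) (w ∷ us) a (b ∷ vs))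
sweep-shrink left a us vs f = sweepʳ a (w ∷ us) (b ∷ vs) f
  (Move-resp refl refl (cong (vacancyAt (w ∷ us)) (alt-rotate black white a vs)) (slide→ us white (b ∷ alt white black a vs)))
sweep-shrink right a us vs f = sweepˡ a (w ∷ us) (b ∷ vs) f
  (Move-resp refl (cong (λ zs → + suc (length zs)) (alt-rotate white black a us))
    (cong (λ zs → vacancyAt zs (b ∷ vs)) (alt-rotate white black a us))
    (slide← (w ∷ alt black white a us) black vs))

-- The three phases as successions of sweeps

state-0 : ∀ s us vs → state s us 0 vs ≡ vacancyAt us vs
state-0 left  us vs = refl
state-0 right us vs = refl

replicate-ʳ++ : ∀ k (z : Cell) zs → replicate k z ʳ++ zs ≡ replicate k z ++ zs
replicate-ʳ++ zero    z zs = refl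
replicate-ʳ++ (suc k) z zs = trans (replicate-ʳ++ k z (z ∷ zs)) (shift k)
  where
  shift : ∀ k → replicate k z ++ z ∷ zs ≡ z ∷ replicate k z ++ zs
  shift zero    = refl
  shift (suc k) = cong (z ∷_) (shift k)

-- The number k(k + 1)/2. For positive k it is also the index of the first move of sweep k in the
-- first phase, as sweep i there has i + 1 moves.
triangle : ℕ → ℕ
triangle zero    = 0
triangle (suc k) = suc (triangle k + k)

-- (γ + k) + (γ + k - 1) + … + (k + 1)
trapezium : ℕ → ℕ → ℕ
trapezium zero    k = 0
trapezium (suc γ) k = trapezium γ (suc k) + suc k

triangle-double : ∀ k → triangle k + triangle k ≡ k * suc k
triangle-double zero    = refl
triangle-double (suc k) = trans (regroup (triangle k) k) (trans (cong (_+ 2 * suc k) (triangle-double k)) (expand k))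
  where
  regroup : ∀ t k → suc (t + k) + suc (t + k) ≡ t + t + 2 * suc k
  regroup = solve-∀
  expand : ∀ k → k * suc k + 2 * suc k ≡ suc k * suc (suc k)
  expand = solve-∀

trapezium+triangle-k : ∀ γ k → trapezium γ k + triangle k ≡ triangle (γ + k)
trapezium+triangle-k zero    k = refl
trapezium+triangle-k (suc γ) k = begin
  trapezium γ (suc k) + suc k + triangle k     ≡⟨ regroup (trapezium γ (suc k)) k (triangle k) ⟩
  trapezium γ (suc k) + triangle (suc k)       ≡⟨ trapezium+triangle-k γ (suc k) ⟩
  triangle (γ + suc k)                         ≡⟨ cong triangle (+-suc γ k) ⟩
  triangle (suc γ + k)                         ∎
  where
  open ≡-Reasoning
  regroup : ∀ u k t → u + suc k + t ≡ u + suc (t + k)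
  regroup = solve-∀

-- Here `X` is arbitrary: legality of the sweeps is separated from the evaluation of the formulas,
-- which enters only through the hypotheses of `Phases`. The parameter `l` stands for n - m.
module Sweeps (m l : ℕ) (s₀ : Side) (X : ℕ → ℤ) where

  n : ℕ
  n = m + l

  side : ℕ → Side
  side zero    = s₀
  side (suc k) = flip (side k)

  Run : ℕ → ℕ → Configuration → Configuration → Set
  Run i k c c′ = Play c (applyUpTo (λ j → X (i + j)) k) c′

  Run-trans : ∀ {i k k′ c c′ c″} → Run i k c c′ → Run (i + k) k′ c′ c″ → Run i (k + k′) c c″
  Run-trans {i} {k} {k′} run run′ = Play-along (sym (applyUpTo-+ (λ j → X (i + j)) k k′))
    (Play-++ run (Play-along (applyUpTo-cong (λ j → cong X (+-assoc i k j)) k′) run′))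

  Run-length : ∀ {i k k′ c c′} → k ≡ k′ → Run i k c c′ → Run i k′ c c′
  Run-length refl run = run

  module Phases
    (phase₁ : ∀ α j → α < m → j ≤ suc α → X (triangle (suc α) + j) ≡ path (side (suc α)) (+ suc n) (suc α) j)
    (phase₂ : ∀ β r j → suc β + r ≡ l → j ≤ m →
              X (suc (triangle m + m + β * suc m) + j) ≡ path (side (m + suc β)) (+ suc (r + m)) m j)
    (phase₃ : ∀ γ k j → suc γ + k ≡ m → j ≤ k →
              X (suc (triangle m + m + l * suc m + trapezium γ (suc k)) + j) ≡ path (side (n + suc γ)) (+ suc m) k j)
    where

    -- Induction with `sweep-grow`; `r` and `t` count the b and w still outside the block. The
    -- initial configuration is the case of an empty block.
    run₁ : ∀ α r t → α + r ≡ n → α + t ≡ m →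
           Run 1 (triangle α + α) (initial n m) (state (side α) (replicate r b) α (replicate t w))
    run₁ zero r t refl refl =
      Play-target (sym (trans (state-0 s₀ (replicate n b) (replicate m w)) (replicate-ʳ++ n b (O ∷ replicate m w)))) []
    run₁ (suc α) r t α+r≡n α+t≡m = Run-length {1} (+-suc (triangle α + α) (suc α)) (Run-trans {1}
      (run₁ α (suc r) (suc t) (trans (+-suc α r) α+r≡n) (trans (+-suc α t) α+t≡m))
      (sweep-grow (side α) α (replicate r b) (replicate t w) _ λ j j≤ →
        trans (phase₁ α j (m+n≤o⇒m≤o (suc α) (≤-reflexive α+t≡m)) j≤)
              (cong (λ k → path (side (suc α)) (+ suc k) (suc α) j)
                (sym (trans (cong (_+ suc α) (length-replicate r)) (trans (+-comm r (suc α)) α+r≡n))))))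

    -- Now every w is in the block, and each `sweep-shift` brings one more b from its left to its
    -- right.
    run₂ : ∀ β r → β + r ≡ l →
           Run (suc (triangle m + m)) (β * suc m) (state (side m) (replicate l b) m [])
               (state (side (m + β)) (replicate r b) m (replicate β b))
    run₂ zero r refl rewrite +-identityʳ m = []
    run₂ (suc β) r β+r≡l = Run-length {suc (triangle m + m)} (+-comm (β * suc m) (suc m)) (Run-trans {suc (triangle m + m)}
      (run₂ β (suc r) (trans (+-suc β r) β+r≡l))
      (Play-target (cong (λ k → state (side k) (replicate r b) m (replicate (suc β) b)) (sym (+-suc m β)))
        (sweep-shift (side (m + β)) m (replicate r b) (replicate β b) _ λ j j≤ →
          trans (phase₂ β r j β+r≡l j≤)
            (cong₂ (λ s k → path s (+ suc (k + m)) m j) (cong side (+-suc m β)) (sym (length-replicate r))))))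

    -- Now all checkers outside the block are in final places, and each `sweep-shrink` releases one
    -- more of either colour until the block is empty.
    run₃ : ∀ γ k → γ + k ≡ m →
           Run (suc (triangle m + m + l * suc m)) (trapezium γ k) (state (side n) [] m (replicate l b))
               (state (side (n + γ)) (replicate γ w) k (replicate (γ + l) b))
    run₃ zero k refl rewrite +-identityʳ (k + l) = []
    run₃ (suc γ) k γ+k≡m = Run-trans {suc (triangle m + m + l * suc m)}
      (run₃ γ (suc k) (trans (+-suc γ k) γ+k≡m))
      (Play-target (cong (λ h → state (side h) (replicate (suc γ) w) k (replicate (suc γ + l) b)) (sym (+-suc n γ)))
        (sweep-shrink (side (n + γ)) k (replicate γ w) (replicate (γ + l) b) _ λ j j≤ →
          trans (phase₃ γ k j γ+k≡m j≤)
            (cong₂ (λ s h → path s (+ suc h) k j) (cong side (+-suc n γ))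
              (sym (trans (cong (λ h → suc h + k) (length-replicate γ)) γ+k≡m)))))

    run : Run 1 (numberOfMoves n m) (initial n m) (final n m)
    run = Play-target end (Run-length {1} total
      (Run-trans {1} (Run-trans {1} (run₁ m l 0 refl (+-identityʳ m)) (run₂ l 0 (+-identityʳ l))) (run₃ m 0 (+-identityʳ m))))
      where
      open ≡-Reasoning
      -- The phases have m(m + 3)/2, l(m + 1) and m(m + 1)/2 moves.
      total : triangle m + m + l * suc m + trapezium m 0 ≡ n * m + n + m
      total = begin
        triangle m + m + l * suc m + trapezium m 0
          ≡⟨ cong (λ t → triangle m + m + l * suc m + t)
               (trans (sym (+-identityʳ _)) (trans (trapezium+triangle-k m 0) (cong triangle (+-identityʳ m)))) ⟩
        triangle m + m + l * suc m + triangle m      ≡⟨ regroup (triangle m) m l ⟩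
        triangle m + triangle m + (m + l * suc m)    ≡⟨ cong (_+ (m + l * suc m)) (triangle-double m) ⟩
        m * suc m + (m + l * suc m)                  ≡⟨ expand m l ⟩
        n * m + n + m                                ∎
        where
        regroup : ∀ t m l → t + m + l * suc m + t ≡ t + t + (m + l * suc m)
        regroup = solve-∀
        expand : ∀ m l → m * suc m + (m + l * suc m) ≡ (m + l) * m + (m + l) + m
        expand = solve-∀
      end : state (side (n + m)) (replicate m w) 0 (replicate n b) ≡ final n m
      end = trans (state-0 (side (n + m)) _ _) (replicate-ʳ++ m w (O ∷ replicate n b))

-- Evaluation of the formulas for xᵢ

*∣∣-mono-≤ : ∀ {i j} → i ℤ.≤ j → i ℤ.* + ℤ.∣ i ∣ ℤ.≤ j ℤ.* + ℤ.∣ j ∣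
*∣∣-mono-≤ (ℤ.-≤- n≤m)            = ℤ.-≤- (s≤s⁻¹ (*-mono-≤ (s≤s n≤m) (s≤s n≤m)))
*∣∣-mono-≤ (ℤ.-≤+ {n = zero})     = ℤ.-≤+
*∣∣-mono-≤ (ℤ.-≤+ {n = suc _})    = ℤ.-≤+
*∣∣-mono-≤ (ℤ.+≤+ {m} {n} m≤n) rewrite sym (ℤ.pos-* m m) | sym (ℤ.pos-* n n) = ℤ.+≤+ (*-mono-≤ m≤n m≤n)

-- Both sides have the same denominator, so monotonicity of t∣t∣ on the integer numerators suffices.
signedSquare-shift-mono-≤ : ∀ p {i j} → i ℤ.≤ j → signedSquare (i ℚᵘ./ 1 ℚᵘ.- p) ℚᵘ.≤ signedSquare (j ℚᵘ./ 1 ℚᵘ.- p)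
signedSquare-shift-mono-≤ p@(mkℚᵘ _ _) i≤j = *≤* (ℤ.*-monoʳ-≤-nonNeg _ (*∣∣-mono-≤ (ℤ.+-monoˡ-≤ _ (ℤ.*-monoʳ-≤-nonNeg _ i≤j))))

-- Otherwise x < j + 1 ≤ i ≤ x.
isFloor-≤ : ∀ {x i j} → IsFloor i x → IsFloor j x → i ℤ.≤ j
isFloor-≤ {p ⊕ q √ s} {i} {j} (i≤x , _) (_ , x<j+1) = ℤ.≮⇒≥ λ j<i →
  ℚᵘ.<⇒≱ x<j+1 (ℚᵘ.≤-trans (signedSquare-shift-mono-≤ p (ℤ.i<j⇒suc[i]≤j j<i)) i≤x)

⌊⌋-unique : ∀ x {i} → IsFloor i x → ⌊ x ⌋ ≡ i
⌊⌋-unique x fl = ℤ.≤-antisym (isFloor-≤ {x} (⌊⌋-isFloor x) fl) (isFloor-≤ {x} fl (⌊⌋-isFloor x))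

-- The comparisons behind both floors, cross-multiplied: A∣A∣/4 against B/4, where the 4 arises from
-- squaring halves. In the negative case the order of the squares is reversed.
module _ {A B : ℤ} {a c : ℕ} where
  private
    square⁺ : A ≡ + a → A ℤ.* + ℤ.∣ A ∣ ≡ + (a * a)
    square⁺ refl = sym (ℤ.pos-* a a)

    square⁻ : A ≡ ℤ.- + a → A ℤ.* + ℤ.∣ A ∣ ≡ ℤ.- + (a * a)
    square⁻ refl = begin
      (ℤ.- + a) ℤ.* + ℤ.∣ ℤ.- + a ∣   ≡⟨ cong (λ z → (ℤ.- + a) ℤ.* + z) (ℤ.∣-i∣≡∣i∣ (+ a)) ⟩
      (ℤ.- + a) ℤ.* + a               ≡⟨ ℤ.neg-distribˡ-* (+ a) (+ a) ⟨
      ℤ.- (+ a ℤ.* + a)               ≡⟨ cong ℤ.-_ (ℤ.pos-* a a) ⟨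
      ℤ.- + (a * a)                   ∎
      where open ≡-Reasoning

  square⁺-≤ : A ≡ + a → B ≡ + c → a * a ≤ c → (A ℤ.* + ℤ.∣ A ∣) ℤ.* + 4 ℤ.≤ B ℤ.* + 4
  square⁺-≤ A≡ refl a²≤c rewrite square⁺ A≡ = ℤ.*-monoʳ-≤-nonNeg (+ 4) (ℤ.+≤+ a²≤c)

  square⁺-> : A ≡ + a → B ≡ + c → c < a * a → B ℤ.* + 4 ℤ.< (A ℤ.* + ℤ.∣ A ∣) ℤ.* + 4
  square⁺-> A≡ refl c<a² rewrite square⁺ A≡ = ℤ.*-monoʳ-<-pos (+ 4) (ℤ.+<+ c<a²)

  square⁻-≤ : A ≡ ℤ.- + a → B ≡ ℤ.- + c → c ≤ a * a → (A ℤ.* + ℤ.∣ A ∣) ℤ.* + 4 ℤ.≤ B ℤ.* + 4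
  square⁻-≤ A≡ refl c≤a² rewrite square⁻ A≡ = ℤ.*-monoʳ-≤-nonNeg (+ 4) (ℤ.neg-mono-≤ (ℤ.+≤+ c≤a²))

  square⁻-> : A ≡ ℤ.- + a → B ≡ ℤ.- + c → a * a < c → B ℤ.* + 4 ℤ.< (A ℤ.* + ℤ.∣ A ∣) ℤ.* + 4
  square⁻-> A≡ refl a²<c rewrite square⁻ A≡ = ℤ.*-monoʳ-<-pos (+ 4) (ℤ.neg-mono-< (ℤ.+<+ a²<c))

-- For i = `triangle α + j`, the number 8i + 1 equals (2α + 1)² + 8j, and j ≤ α keeps it below (2α +
-- 3)².
floor-triangle : ∀ α j → j ≤ α → ⌊ -½ ⊕ ½ √ ((+ (8 * (triangle α + j) + 1)) ℚᵘ./ 1) ⌋ ≡ + α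
floor-triangle α j j≤α = ⌊⌋-unique (-½ ⊕ ½ √ ((+ (8 * (triangle α + j) + 1)) ℚᵘ./ 1))
  ( *≤* (square⁺-≤ (half α) radicand lower)
  , *<* (square⁺-> (half (suc α)) radicand upper) )
  where
  c = 8 * (triangle α + j) + 1
  half : ∀ k → + k ℤ.* + 2 ℤ.+ + 1 ≡ + (k * 2 + 1)
  half k = cong (ℤ._+ + 1) (sym (ℤ.pos-* k 2))
  radicand : + 1 ℤ.* + c ≡ + c
  radicand = ℤ.*-identityˡ (+ c)
  c≡ : c ≡ (α * 2 + 1) * (α * 2 + 1) + 8 * j
  c≡ = begin
    8 * (triangle α + j) + 1                      ≡⟨ regroup (triangle α) j ⟩
    4 * (triangle α + triangle α) + (8 * j + 1)   ≡⟨ cong (λ t → 4 * t + (8 * j + 1)) (triangle-double α) ⟩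
    4 * (α * suc α) + (8 * j + 1)                 ≡⟨ expand α j ⟩
    (α * 2 + 1) * (α * 2 + 1) + 8 * j             ∎
    where
    open ≡-Reasoning
    regroup : ∀ t j → 8 * (t + j) + 1 ≡ 4 * (t + t) + (8 * j + 1)
    regroup = solve-∀
    expand : ∀ α j → 4 * (α * suc α) + (8 * j + 1) ≡ (α * 2 + 1) * (α * 2 + 1) + 8 * j
    expand = solve-∀
  lower : (α * 2 + 1) * (α * 2 + 1) ≤ c
  lower = ≤-trans (m≤m+n _ (8 * j)) (≤-reflexive (sym c≡))
  upper : c < (suc α * 2 + 1) * (suc α * 2 + 1)
  upper = begin-strict
    c                                           ≡⟨ c≡ ⟩
    (α * 2 + 1) * (α * 2 + 1) + 8 * j           ≤⟨ +-monoʳ-≤ ((α * 2 + 1) * (α * 2 + 1)) (*-monoʳ-≤ 8 j≤α) ⟩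
    (α * 2 + 1) * (α * 2 + 1) + 8 * α           <⟨ m<m+n _ {8} z<s ⟩
    (α * 2 + 1) * (α * 2 + 1) + 8 * α + 8       ≡⟨ expand α ⟩
    (suc α * 2 + 1) * (suc α * 2 + 1)           ∎
    where
    open ≤-Reasoning
    expand : ∀ α → (α * 2 + 1) * (α * 2 + 1) + 8 * α + 8 ≡ (suc α * 2 + 1) * (suc α * 2 + 1)
    expand = solve-∀

-- The root has to lie above k + 1/2 and not above k + 3/2. Four times the radicand is (2k + 1)² +
-- 8r + 8, which attains (2k + 3)² for r = k.
floor-trapezium : ∀ γ k r S → r ≤ k → S ≡ + (k * suc k + 2 * r) →
  ⌊ ((+ (γ + k)) ℚᵘ./ 1 ℚᵘ.+ (+ 3) ℚᵘ./ 2) ⊕ (ℚᵘ.- 1ℚᵘ) √ (S ℚᵘ./ 1 ℚᵘ.+ (+ 9) ℚᵘ./ 4) ⌋ ≡ + γ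
floor-trapezium γ k r S r≤k refl = ⌊⌋-unique
  (((+ (γ + k)) ℚᵘ./ 1 ℚᵘ.+ (+ 3) ℚᵘ./ 2) ⊕ (ℚᵘ.- 1ℚᵘ) √ (S ℚᵘ./ 1 ℚᵘ.+ (+ 9) ℚᵘ./ 4))
  ( *≤* (square⁻-≤ (trans (half (+ γ) (+ k)) (cong ℤ.-_ (sym (double k 3)))) radicand lower)
  , *<* (square⁻-> (trans (half′ (+ γ) (+ k)) (cong ℤ.-_ (sym (double k 1)))) radicand upper) )
  where
  c = (k * suc k + 2 * r) * 4 + 9
  double : ∀ k h → + (k * 2 + h) ≡ + k ℤ.* + 2 ℤ.+ + h
  double k h = cong (ℤ._+ + h) (ℤ.pos-* k 2)
  half : ∀ γ k → γ ℤ.* + 2 ℤ.+ (ℤ.- ((γ ℤ.+ k) ℤ.* + 2 ℤ.+ + 3)) ℤ.* + 1 ≡ ℤ.- (k ℤ.* + 2 ℤ.+ + 3)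
  half = ℤ-Solver.solve-∀
  half′ : ∀ γ k → (1ℤ ℤ.+ γ) ℤ.* + 2 ℤ.+ (ℤ.- ((γ ℤ.+ k) ℤ.* + 2 ℤ.+ + 3)) ℤ.* + 1 ≡ ℤ.- (k ℤ.* + 2 ℤ.+ + 1)
  half′ = ℤ-Solver.solve-∀
  radicand : -1ℤ ℤ.* ((+ (k * suc k + 2 * r)) ℤ.* + 4 ℤ.+ + 9) ≡ ℤ.- + c
  radicand = trans (ℤ.-1*i≡-i _) (cong (λ z → ℤ.- (z ℤ.+ + 9)) (sym (ℤ.pos-* (k * suc k + 2 * r) 4)))
  lower : c ≤ (k * 2 + 3) * (k * 2 + 3)
  lower = begin
    (k * suc k + 2 * r) * 4 + 9    ≤⟨ +-monoˡ-≤ 9 (*-monoˡ-≤ 4 (+-monoʳ-≤ (k * suc k) (*-monoʳ-≤ 2 r≤k))) ⟩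
    (k * suc k + 2 * k) * 4 + 9    ≡⟨ expand k ⟩
    (k * 2 + 3) * (k * 2 + 3)      ∎
    where
    open ≤-Reasoning
    expand : ∀ k → (k * suc k + 2 * k) * 4 + 9 ≡ (k * 2 + 3) * (k * 2 + 3)
    expand = solve-∀
  upper : (k * 2 + 1) * (k * 2 + 1) < c
  upper = begin-strict
    (k * 2 + 1) * (k * 2 + 1)                      <⟨ m<m+n _ {8 * r + 8} (≤-trans z<s (m≤n+m 8 (8 * r))) ⟩
    (k * 2 + 1) * (k * 2 + 1) + (8 * r + 8)        ≡⟨ expand k r ⟩
    (k * suc k + 2 * r) * 4 + 9                    ∎
    where
    open ≤-Reasoning
    expand : ∀ k r → (k * 2 + 1) * (k * 2 + 1) + (8 * r + 8) ≡ (k * suc k + 2 * r) * 4 + 9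
    expand = solve-∀

-- Conditionals, quotients, signs and sums occurring in the formulas

if-≤ : ∀ {i j} {y z : ℤ} → i ≤ j → (if i ≤ᵇ j then y else z) ≡ y
if-≤ {i} {j} i≤j with i ≤ᵇ j | ≤⇒≤ᵇ i≤j
... | true | _ = refl

if-> : ∀ {i j} {y z : ℤ} → j < i → (if i ≤ᵇ j then y else z) ≡ z
if-> {i} {j} j<i with i ≤ᵇ j in eq
... | true  = contradiction (≤ᵇ⇒≤ i j (subst T (sym eq) tt)) (<⇒≱ j<i)
... | false = refl

[j+k*m]/m≡k : ∀ j k m → j ≤ m → (+ (j + k * suc m)) ℤ./ (+ suc m) ≡ + k
[j+k*m]/m≡k j k m j≤m = trans (ℤ.div-pos-is-/ℕ (+ (j + k * suc m)) (suc m)) (cong +_ (begin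
  (j + k * suc m) / suc m              ≡⟨ +-distrib-/-∣ʳ j (divides-refl k) ⟩
  j / suc m + k * suc m / suc m        ≡⟨ cong₂ _+_ (m<n⇒m/n≡0 (s≤s j≤m)) (m*n/n≡m k (suc m)) ⟩
  k                                    ∎))
  where open ≡-Reasoning

[-1]^-square : ∀ k → [-1]^ (+ k) ℤ.* [-1]^ (+ k) ≡ 1ℤ
[-1]^-square zero    = refl
[-1]^-square (suc k) = trans (ring ([-1]^ (+ k))) ([-1]^-square k)
  where
  ring : ∀ e → (-1ℤ ℤ.* e) ℤ.* (-1ℤ ℤ.* e) ≡ e ℤ.* e
  ring = ℤ-Solver.solve-∀

sgn-flip : ∀ s → sgn (flip s) ≡ -1ℤ ℤ.* sgn s
sgn-flip left  = refl
sgn-flip right = refl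

triangle-mono-≤ : ∀ {j k} → j ≤ k → triangle j ≤ triangle k
triangle-mono-≤ z≤n       = z≤n
triangle-mono-≤ (s≤s j≤k) = s≤s (+-mono-≤ (triangle-mono-≤ j≤k) j≤k)

-- Pairing (γ + k) + ... + (k + 1) with 1 + ... + γ gives γ pairs of sum γ + k + 1. This is the
-- source of the terms (γ - 1)(m + 1) and γ(γ - 1)/2 in `q`.
trapezium+triangle-γ : ∀ γ k → trapezium γ k + triangle γ ≡ γ * suc (γ + k)
trapezium+triangle-γ zero    k = refl
trapezium+triangle-γ (suc γ) k = begin
  trapezium γ (suc k) + suc k + suc (triangle γ + γ)     ≡⟨ regroup (trapezium γ (suc k)) (triangle γ) γ k ⟩
  trapezium γ (suc k) + triangle γ + (suc k + suc γ)     ≡⟨ cong (_+ (suc k + suc γ)) (trapezium+triangle-γ γ (suc k)) ⟩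
  γ * suc (γ + suc k) + (suc k + suc γ)                  ≡⟨ expand γ k ⟩
  suc γ * suc (suc γ + k)                                ∎
  where
  open ≡-Reasoning
  regroup : ∀ u t γ k → u + suc k + suc (t + γ) ≡ u + t + (suc k + suc γ)
  regroup = solve-∀
  expand : ∀ γ k → γ * suc (γ + suc k) + (suc k + suc γ) ≡ suc γ * suc (suc γ + k)
  expand = solve-∀

triangle-doubleℤ : ∀ k → + triangle k ℤ.+ + triangle k ≡ + k ℤ.* (1ℤ ℤ.+ + k)
triangle-doubleℤ k = trans (cong +_ (triangle-double k)) (ℤ.pos-* k (suc k))

-- The values of the sequence in its three ranges

module Values (m l : ℕ) (s₀ : Side) where

  -- The empty initial block may be placed on either side of the vacancy. Regarding the vacancy as
  -- its left end makes the first slide take the vacancy to the left, which is d = 1.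
  d : ℤ
  d = sgn s₀

  open Sequence (m + l) m d hiding (x)
  open Sweeps m l s₀ (x (m + l) m d)

  s₁≡ : s₁ ≡ triangle m + m
  s₁≡ = trans (cong (_/ 2) (sym double)) (m*n/n≡m (triangle m + m) 2)
    where
    regroup : ∀ t m → (t + m) * 2 ≡ t + t + 2 * m
    regroup = solve-∀
    expand : ∀ m → m * suc m + 2 * m ≡ m * (m + 3)
    expand = solve-∀
    double : (triangle m + m) * 2 ≡ m * (m + 3)
    double = trans (regroup (triangle m) m) (trans (cong (_+ 2 * m) (triangle-double m)) (expand m))

  s₂≡ : s₂ ≡ l * suc m
  s₂≡ = cong₂ _*_ (m+n∸m≡n m l) (+-comm m 1)

  s₁+s₂≡ : s₁ + s₂ ≡ triangle m + m + l * suc m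
  s₁+s₂≡ = cong₂ _+_ s₁≡ s₂≡

  sgn-side : ∀ k → sgn (side k) ≡ [-1]^ (+ k) ℤ.* d
  sgn-side zero    = sym (ℤ.*-identityˡ d)
  sgn-side (suc k) = trans (sgn-flip (side k)) (trans (cong (-1ℤ ℤ.*_) (sgn-side k)) (sym (ℤ.*-assoc -1ℤ ([-1]^ (+ k)) d)))

  -- With α = k and i = `triangle k + j`, the factor 2i - k(k + 2) becomes k(k + 1) + 2j - k(k + 2)
  -- = 2j - k.
  first-value : ∀ k j → j ≤ k → first (triangle k + j) ≡ path (side k) (+ suc n) k j
  first-value k j j≤k = begin
    first i                                                       ≡⟨ cong F (floor-triangle k j j≤k) ⟩
    F (+ k)                                                       ≡⟨ collect (+ n) ([-1]^ (+ k)) d (+ triangle k) (+ j) (+ k) ⟩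
    G (+ triangle k ℤ.+ + triangle k)                             ≡⟨ cong G (triangle-doubleℤ k) ⟩
    G (+ k ℤ.* (1ℤ ℤ.+ + k))                                      ≡⟨ simplify (+ n) ([-1]^ (+ k)) d (+ j) (+ k) ⟩
    1ℤ ℤ.+ + n - [-1]^ (+ k) ℤ.* d ℤ.* (+ 2 ℤ.* + j - + k)         ≡⟨ cong (λ e → + suc n - e ℤ.* (+ 2 ℤ.* + j - + k)) (sgn-side k) ⟨
    path (side k) (+ suc n) k j                                   ∎
    where
    open ≡-Reasoning
    i = triangle k + j
    F G : ℤ → ℤ
    F a = + n ℤ.+ + 1 - [-1]^ a ℤ.* d ℤ.* (+ 2 ℤ.* + i - a ℤ.* (a ℤ.+ + 2))
    G t = + n ℤ.+ + 1 - [-1]^ (+ k) ℤ.* d ℤ.* (t ℤ.+ + 2 ℤ.* + j - + k ℤ.* (+ k ℤ.+ + 2))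
    collect : ∀ n e d t j k → n ℤ.+ + 1 - e ℤ.* d ℤ.* (+ 2 ℤ.* (t ℤ.+ j) - k ℤ.* (k ℤ.+ + 2)) ≡
                              n ℤ.+ + 1 - e ℤ.* d ℤ.* (t ℤ.+ t ℤ.+ + 2 ℤ.* j - k ℤ.* (k ℤ.+ + 2))
    collect = ℤ-Solver.solve-∀
    simplify : ∀ n e d j k → n ℤ.+ + 1 - e ℤ.* d ℤ.* (k ℤ.* (1ℤ ℤ.+ k) ℤ.+ + 2 ℤ.* j - k ℤ.* (k ℤ.+ + 2)) ≡
                             1ℤ ℤ.+ n - e ℤ.* d ℤ.* (+ 2 ℤ.* j - k)
    simplify = ℤ-Solver.solve-∀

  first-s₁ : first s₁ ≡ path (side m) (+ suc n) m m
  first-s₁ = trans (cong first s₁≡) (first-value m m ≤-refl)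

  -- The value at s₁ is off the centre n + 1 by (-1)^m d m. The term m(-1)^β of the formula
  -- compensates this, because the square of (-1)^β is 1.
  second-value : ∀ k r j → suc k + r ≡ l → j ≤ m →
    second (first s₁) (suc (triangle m + m + k * suc m) + j) ≡ path (side (m + suc k)) (+ suc (r + m)) m j
  second-value k r j refl j≤m = begin
    second (first s₁) i   ≡⟨ cong (F (first s₁) (p i)) β≡ ⟩
    F (first s₁) (p i) (+ suc k)   ≡⟨ cong₂ (λ y z → F y z (+ suc k)) first-s₁ p≡ ⟩
    F (path (side m) (+ suc n) m m) (+ suc j) (+ suc k)
      ≡⟨ cong₂ (λ y z → G y z) (sgn-side m) (ℤ.^-distribˡ-+-* -1ℤ m (suc k)) ⟩
    G (e ℤ.* d) (e ℤ.* f)    ≡⟨ collect (+ m) (+ suc k) (+ r) (+ j) e f d ⟩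
    H (f ℤ.* f)    ≡⟨ cong H ([-1]^-square (suc k)) ⟩
    H 1ℤ           ≡⟨ simplify (+ m) (+ r) (+ j) e f d ⟩
    1ℤ ℤ.+ (+ r ℤ.+ + m) - e ℤ.* f ℤ.* d ℤ.* (+ 2 ℤ.* + j - + m)
      ≡⟨ cong (λ z → + suc (r + m) - z ℤ.* (+ 2 ℤ.* + j - + m))
           (trans (sgn-side (m + suc k)) (cong (ℤ._* d) (ℤ.^-distribˡ-+-* -1ℤ m (suc k)))) ⟨
    path (side (m + suc k)) (+ suc (r + m)) m j   ∎
    where
    open ≡-Reasoning
    i = suc (triangle m + m + k * suc m) + j
    e = [-1]^ (+ m)
    f = [-1]^ (+ suc k)
    F : ℤ → ℤ → ℤ → ℤ
    F y p b = y - b - [-1]^ (+ m ℤ.+ b) ℤ.* d ℤ.* (+ 2 ℤ.* p - + 2 - + m ℤ.* (+ 1 ℤ.+ [-1]^ b))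
    G : ℤ → ℤ → ℤ
    G y z = 1ℤ ℤ.+ (+ m ℤ.+ (+ suc k ℤ.+ + r)) - y ℤ.* (+ 2 ℤ.* + m - + m) - + suc k
            - z ℤ.* d ℤ.* (+ 2 ℤ.* (1ℤ ℤ.+ + j) - + 2 - + m ℤ.* (+ 1 ℤ.+ f))
    H : ℤ → ℤ
    H u = 1ℤ ℤ.+ (+ r ℤ.+ + m) - e ℤ.* f ℤ.* d ℤ.* (+ 2 ℤ.* + j - + m) ℤ.+ e ℤ.* d ℤ.* + m ℤ.* (u - 1ℤ)
    collect : ∀ m b r j e f d →
      1ℤ ℤ.+ (m ℤ.+ (b ℤ.+ r)) - e ℤ.* d ℤ.* (+ 2 ℤ.* m - m) - b
        - e ℤ.* f ℤ.* d ℤ.* (+ 2 ℤ.* (1ℤ ℤ.+ j) - + 2 - m ℤ.* (+ 1 ℤ.+ f)) ≡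
      1ℤ ℤ.+ (r ℤ.+ m) - e ℤ.* f ℤ.* d ℤ.* (+ 2 ℤ.* j - m) ℤ.+ e ℤ.* d ℤ.* m ℤ.* (f ℤ.* f - 1ℤ)
    collect = ℤ-Solver.solve-∀
    simplify : ∀ m r j e f d →
      1ℤ ℤ.+ (r ℤ.+ m) - e ℤ.* f ℤ.* d ℤ.* (+ 2 ℤ.* j - m) ℤ.+ e ℤ.* d ℤ.* m ℤ.* (1ℤ - 1ℤ) ≡
      1ℤ ℤ.+ (r ℤ.+ m) - e ℤ.* f ℤ.* d ℤ.* (+ 2 ℤ.* j - m)
    simplify = ℤ-Solver.solve-∀
    offset : ∀ t m B j → 1ℤ ℤ.+ (t ℤ.+ m ℤ.+ B) ℤ.+ j - (t ℤ.+ m) ℤ.+ m ≡ j ℤ.+ (1ℤ ℤ.+ m ℤ.+ B)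
    offset = ℤ-Solver.solve-∀
    -- The numerator i - s₁ + m is j + (k + 1)(m + 1) with j ≤ m.
    β≡ : β i ≡ + suc k
    β≡ = trans (cong (ℤ._/ (+ suc m))
                 (trans (cong (λ z → + i - + z ℤ.+ + m) s₁≡) (offset (+ triangle m) (+ m) (+ (k * suc m)) (+ j))))
               ([j+k*m]/m≡k j (suc k) m j≤m)
    remainder : ∀ t m k j → 1ℤ ℤ.+ (t ℤ.+ m ℤ.+ k ℤ.* (1ℤ ℤ.+ m)) ℤ.+ j - (t ℤ.+ m) - ((1ℤ ℤ.+ k) - + 1) ℤ.* (m ℤ.+ + 1) ≡ 1ℤ ℤ.+ j
    remainder = ℤ-Solver.solve-∀
    p≡ : p i ≡ + suc j
    p≡ = begin
      + i - + s₁ - (β i - + 1) ℤ.* (+ m ℤ.+ + 1)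
        ≡⟨ cong₂ (λ z y → + i - + z - (y - + 1) ℤ.* (+ m ℤ.+ + 1)) s₁≡ β≡ ⟩
      + i - + (triangle m + m) - (+ suc k - + 1) ℤ.* (+ m ℤ.+ + 1)
        ≡⟨ cong (λ z → 1ℤ ℤ.+ (+ triangle m ℤ.+ + m ℤ.+ z) ℤ.+ + j - + (triangle m + m) - (+ suc k - + 1) ℤ.* (+ m ℤ.+ + 1))
             (ℤ.pos-* k (suc m)) ⟩
      1ℤ ℤ.+ (+ triangle m ℤ.+ + m ℤ.+ + k ℤ.* + suc m) ℤ.+ + j - + (triangle m + m) - (+ suc k - + 1) ℤ.* (+ m ℤ.+ + 1)
        ≡⟨ remainder (+ triangle m) (+ m) (+ k) (+ j) ⟩
      + suc j ∎

  second-in-range : ∀ k r j → suc k + r ≡ l → j ≤ m → suc (triangle m + m + k * suc m) + j ≤ triangle m + m + l * suc m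
  second-in-range k r j refl j≤m = begin
    suc (triangle m + m + k * suc m) + j      ≡⟨ regroup (triangle m + m) (k * suc m) j ⟩
    triangle m + m + (suc j + k * suc m)      ≤⟨ +-monoʳ-≤ (triangle m + m) (+-monoˡ-≤ (k * suc m) (s≤s j≤m)) ⟩
    triangle m + m + suc k * suc m            ≤⟨ +-monoʳ-≤ (triangle m + m) (*-monoˡ-≤ (suc m) (m≤m+n (suc k) r)) ⟩
    triangle m + m + (suc k + r) * suc m      ∎
    where
    open ≤-Reasoning
    regroup : ∀ s u j → suc (s + u) + j ≡ s + (suc j + u)
    regroup = solve-∀

  x₁₂-first : ∀ {i} → i ≤ triangle m + m → x₁₂ i ≡ first i
  x₁₂-first i≤ = if-≤ (≤-trans i≤ (≤-reflexive (sym s₁≡)))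

  x₁₂-second : ∀ k r j → suc k + r ≡ l → j ≤ m →
    x₁₂ (suc (triangle m + m + k * suc m) + j) ≡ path (side (m + suc k)) (+ suc (r + m)) m j
  x₁₂-second k r j eq j≤m = trans
    (if-> (≤-trans (s≤s (≤-reflexive s₁≡)) (s≤s (≤-trans (m≤m+n _ (k * suc m)) (m≤m+n _ j)))))
    (second-value k r j eq j≤m)

  x₁₂-last : x₁₂ (s₁ + s₂) ≡ path (side n) (+ suc m) m m
  x₁₂-last = trans (cong x₁₂ s₁+s₂≡) (last l refl)
    where
    -- If l = 0 the second range is empty and the value comes from the first. The case distinction
    -- is made on a copy `h` because `l` is a module parameter.
    last : ∀ h → h ≡ l → x₁₂ (triangle m + m + l * suc m) ≡ path (side n) (+ suc m) m m
    last zero refl = begin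
      x₁₂ (triangle m + m + 0)            ≡⟨ cong x₁₂ (+-identityʳ (triangle m + m)) ⟩
      x₁₂ (triangle m + m)                ≡⟨ x₁₂-first ≤-refl ⟩
      first (triangle m + m)              ≡⟨ first-value m m ≤-refl ⟩
      path (side m) (+ suc (m + 0)) m m   ≡⟨ cong₂ (λ h h′ → path (side h) (+ suc h′) m m) (sym (+-identityʳ m)) (+-identityʳ m) ⟩
      path (side (m + 0)) (+ suc m) m m   ∎
      where open ≡-Reasoning
    last (suc k) refl = trans (cong x₁₂ (regroup (triangle m) m (k * suc m))) (x₁₂-second k 0 m (+-identityʳ (suc k)) ≤-refl)
      where
      regroup : ∀ t m u → t + m + (suc m + u) ≡ suc (t + m + u) + m
      regroup = solve-∀

  -- The value at s₁ + s₂ is off the centre m + 1 by (-1)^n d m, which the last term of the formula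
  -- cancels. With q = j + 1 and m = γ + k, the factor γ + 2q - m - 2 is 2j - k.
  third-value : ∀ g k j → suc g + k ≡ m → j ≤ k →
    third (x₁₂ (s₁ + s₂)) (suc (triangle m + m + l * suc m + trapezium g (suc k)) + j) ≡ path (side (n + suc g)) (+ suc m) k j
  third-value g k j g+k≡m j≤k = begin
    third (x₁₂ (s₁ + s₂)) i                        ≡⟨ cong (F (x₁₂ (s₁ + s₂)) (q i)) γ≡ ⟩
    F (x₁₂ (s₁ + s₂)) (q i) (+ suc g)              ≡⟨ cong₂ (λ y z → F y z (+ suc g)) x₁₂-last q≡ ⟩
    F (path (side n) (+ suc m) m m) (+ suc j) (+ suc g)
      ≡⟨ cong₂ (λ y h → G y (+ h)) (sgn-side n) (sym g+k≡m) ⟩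
    G ([-1]^ (+ n) ℤ.* d) (+ suc g ℤ.+ + k)        ≡⟨ simplify (+ m) (+ suc g) (+ k) (+ j) ([-1]^ (+ n)) ([-1]^ (+ (n + suc g))) d ⟩
    1ℤ ℤ.+ + m - [-1]^ (+ (n + suc g)) ℤ.* d ℤ.* (+ 2 ℤ.* + j - + k)
      ≡⟨ cong (λ z → + suc m - z ℤ.* (+ 2 ℤ.* + j - + k)) (sgn-side (n + suc g)) ⟨
    path (side (n + suc g)) (+ suc m) k j          ∎
    where
    open ≡-Reasoning
    u = trapezium g (suc k)
    i = suc (triangle m + m + l * suc m + u) + j
    F : ℤ → ℤ → ℤ → ℤ
    F y q c = y - d ℤ.* ([-1]^ (+ n ℤ.+ c) ℤ.* (c ℤ.+ + 2 ℤ.* q - + m - + 2) - + m ℤ.* [-1]^ (+ n))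
    G : ℤ → ℤ → ℤ
    G y h = 1ℤ ℤ.+ + m - y ℤ.* (+ 2 ℤ.* + m - + m)
            - d ℤ.* ([-1]^ (+ (n + suc g)) ℤ.* (+ suc g ℤ.+ + 2 ℤ.* (1ℤ ℤ.+ + j) - h - + 2) - + m ℤ.* [-1]^ (+ n))
    simplify : ∀ m g k j e f d →
      1ℤ ℤ.+ m - e ℤ.* d ℤ.* (+ 2 ℤ.* m - m) - d ℤ.* (f ℤ.* (g ℤ.+ + 2 ℤ.* (1ℤ ℤ.+ j) - (g ℤ.+ k) - + 2) - m ℤ.* e) ≡
      1ℤ ℤ.+ m - f ℤ.* d ℤ.* (+ 2 ℤ.* j - k)
    simplify = ℤ-Solver.solve-∀

    offset : + i - + s₁ - + s₂ ≡ 1ℤ ℤ.+ (+ u ℤ.+ + j)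
    offset = trans (cong₂ (λ z z′ → + i - + z - + z′) s₁≡ s₂≡) (ring (+ (triangle m + m)) (+ (l * suc m)) (+ u) (+ j))
      where
      ring : ∀ s s′ u j → 1ℤ ℤ.+ (s ℤ.+ s′ ℤ.+ u) ℤ.+ j - s - s′ ≡ 1ℤ ℤ.+ (u ℤ.+ j)
      ring = ℤ-Solver.solve-∀

    r = k ∸ j

    triangle-m : + triangle m ≡ + u ℤ.+ (1ℤ ℤ.+ (+ triangle k ℤ.+ + k))
    triangle-m = cong +_ (sym (trans (trapezium+triangle-k g (suc k)) (cong triangle (trans (+-suc g k) g+k≡m))))

    -- This is twice the number of moves after move i: r in the current sweep and `triangle k` in
    -- the later ones.
    radicand : + m ℤ.* (+ m ℤ.+ + 1) - + 2 ℤ.* (+ i - + s₁ - + s₂) ≡ + (k * suc k + 2 * r)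
    radicand = begin
      + m ℤ.* (+ m ℤ.+ + 1) - + 2 ℤ.* (+ i - + s₁ - + s₂)
        ≡⟨ cong₂ (λ y z → y - + 2 ℤ.* z) (trans (cong (+ m ℤ.*_) (ℤ.+-comm (+ m) (+ 1))) (sym (triangle-doubleℤ m))) offset ⟩
      + triangle m ℤ.+ + triangle m - + 2 ℤ.* (1ℤ ℤ.+ (+ u ℤ.+ + j))
        ≡⟨ cong (λ z → z ℤ.+ z - + 2 ℤ.* (1ℤ ℤ.+ (+ u ℤ.+ + j))) triangle-m ⟩
      R (+ k)
        ≡⟨ cong (λ h → R (+ h)) (m+[n∸m]≡n j≤k) ⟨
      R (+ j ℤ.+ + r)
        ≡⟨ ring (+ u) (+ triangle k) (+ j) (+ r) ⟩
      + triangle k ℤ.+ + triangle k ℤ.+ + 2 ℤ.* + r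
        ≡⟨ cong₂ ℤ._+_ (cong +_ (triangle-double k)) (sym (ℤ.pos-* 2 r)) ⟩
      + (k * suc k + 2 * r) ∎
      where
      R : ℤ → ℤ
      R z = (+ u ℤ.+ (1ℤ ℤ.+ (+ triangle k ℤ.+ z))) ℤ.+ (+ u ℤ.+ (1ℤ ℤ.+ (+ triangle k ℤ.+ z))) - + 2 ℤ.* (1ℤ ℤ.+ (+ u ℤ.+ + j))
      ring : ∀ u t j r → (u ℤ.+ (1ℤ ℤ.+ (t ℤ.+ (j ℤ.+ r)))) ℤ.+ (u ℤ.+ (1ℤ ℤ.+ (t ℤ.+ (j ℤ.+ r)))) - + 2 ℤ.* (1ℤ ℤ.+ (u ℤ.+ j)) ≡
                         t ℤ.+ t ℤ.+ + 2 ℤ.* r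
      ring = ℤ-Solver.solve-∀

    γ≡ : γ i ≡ + suc g
    γ≡ = trans (cong (λ h → ⌊ ((+ h) ℚᵘ./ 1 ℚᵘ.+ (+ 3) ℚᵘ./ 2) ⊕ (ℚᵘ.- 1ℚᵘ) √ (S ℚᵘ./ 1 ℚᵘ.+ (+ 9) ℚᵘ./ 4) ⌋) (sym g+k≡m))
               (floor-trapezium (suc g) k r S (m∸n≤m k j) radicand)
      where S = + m ℤ.* (+ m ℤ.+ + 1) - + 2 ℤ.* (+ i - + s₁ - + s₂)

    half : (+ suc g ℤ.* (+ suc g - + 1)) ℤ./ + 2 ≡ + triangle g
    half = trans (cong (ℤ._/ + 2) even) ([j+k*m]/m≡k 0 (triangle g) 1 z≤n)
      where
      ring : ∀ g → (1ℤ ℤ.+ g) ℤ.* ((1ℤ ℤ.+ g) - + 1) ≡ g ℤ.* (1ℤ ℤ.+ g)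
      ring = ℤ-Solver.solve-∀
      twice : ∀ t → t + t ≡ t * 2
      twice = solve-∀
      even : + suc g ℤ.* (+ suc g - + 1) ≡ + (triangle g * 2)
      even = trans (ring (+ g)) (trans (sym (triangle-doubleℤ g)) (cong +_ (twice (triangle g))))

    u+triangle-g : + u ℤ.+ + triangle g ≡ + g ℤ.* (1ℤ ℤ.+ + m)
    u+triangle-g = trans (cong +_ (trans (trapezium+triangle-γ g (suc k)) (cong (λ h → g * suc h) (trans (+-suc g k) g+k≡m)))) (ℤ.pos-* g (suc m))

    q≡ : q i ≡ + suc j
    q≡ = begin
      + i - + s₁ - + s₂ - (γ i - + 1) ℤ.* (+ m ℤ.+ + 1) ℤ.+ (γ i ℤ.* (γ i - + 1)) ℤ./ + 2
        ≡⟨ cong₂ (λ y z → y - (z - + 1) ℤ.* (+ m ℤ.+ + 1) ℤ.+ (z ℤ.* (z - + 1)) ℤ./ + 2) offset γ≡ ⟩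
      1ℤ ℤ.+ (+ u ℤ.+ + j) - (+ suc g - + 1) ℤ.* (+ m ℤ.+ + 1) ℤ.+ (+ suc g ℤ.* (+ suc g - + 1)) ℤ./ + 2
        ≡⟨ cong (λ z → 1ℤ ℤ.+ (+ u ℤ.+ + j) - (+ suc g - + 1) ℤ.* (+ m ℤ.+ + 1) ℤ.+ z) half ⟩
      1ℤ ℤ.+ (+ u ℤ.+ + j) - (+ suc g - + 1) ℤ.* (+ m ℤ.+ + 1) ℤ.+ + triangle g
        ≡⟨ collect (+ u) (+ triangle g) (+ j) (+ g) (+ m) ⟩
      (+ u ℤ.+ + triangle g) - + g ℤ.* (1ℤ ℤ.+ + m) ℤ.+ (1ℤ ℤ.+ + j)
        ≡⟨ cong (λ z → z - + g ℤ.* (1ℤ ℤ.+ + m) ℤ.+ (1ℤ ℤ.+ + j)) u+triangle-g ⟩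
      + g ℤ.* (1ℤ ℤ.+ + m) - + g ℤ.* (1ℤ ℤ.+ + m) ℤ.+ (1ℤ ℤ.+ + j)
        ≡⟨ cong (ℤ._+ + suc j) (ℤ.+-inverseʳ (+ g ℤ.* (1ℤ ℤ.+ + m))) ⟩
      + suc j ∎
      where
      collect : ∀ u t j g m → 1ℤ ℤ.+ (u ℤ.+ j) - ((1ℤ ℤ.+ g) - + 1) ℤ.* (m ℤ.+ + 1) ℤ.+ t ≡
                              (u ℤ.+ t) - g ℤ.* (1ℤ ℤ.+ m) ℤ.+ (1ℤ ℤ.+ j)
      collect = ℤ-Solver.solve-∀

  x-x₁₂ : ∀ {i} → i ≤ triangle m + m + l * suc m → x n m d i ≡ x₁₂ i
  x-x₁₂ i≤ = if-≤ (≤-trans i≤ (≤-reflexive (sym s₁+s₂≡)))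

  x-first : ∀ k j → k < m → j ≤ suc k → x n m d (triangle (suc k) + j) ≡ path (side (suc k)) (+ suc n) (suc k) j
  x-first k j k<m j≤ = trans (x-x₁₂ (≤-trans i≤ (m≤m+n _ (l * suc m)))) (trans (x₁₂-first i≤) (first-value (suc k) j j≤))
    where i≤ = +-mono-≤ (triangle-mono-≤ k<m) (≤-trans j≤ k<m)

  x-second : ∀ k r j → suc k + r ≡ l → j ≤ m →
    x n m d (suc (triangle m + m + k * suc m) + j) ≡ path (side (m + suc k)) (+ suc (r + m)) m j
  x-second k r j eq j≤m = trans (x-x₁₂ (second-in-range k r j eq j≤m)) (x₁₂-second k r j eq j≤m)

  x-third : ∀ g k j → suc g + k ≡ m → j ≤ k →
    x n m d (suc (triangle m + m + l * suc m + trapezium g (suc k)) + j) ≡ path (side (n + suc g)) (+ suc m) k j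
  x-third g k j eq j≤k = trans
    (if-> (≤-trans (s≤s (≤-reflexive s₁+s₂≡)) (s≤s (≤-trans (m≤m+n _ (trapezium g (suc k))) (m≤m+n _ j)))))
    (third-value g k j eq j≤k)

  play : Play (initial n m) (moves n m d) (final n m)
  play = Phases.run x-first x-second x-third

  first-direction : 1 ≤ m → d ≡ + (n + 1) - x n m d 1
  first-direction 1≤m = sym (begin
    + (n + 1) - x n m d 1
      ≡⟨ cong (+ (n + 1) -_) (x-first 0 0 1≤m z≤n) ⟩
    + (n + 1) - (+ suc n - sgn (flip s₀) ℤ.* (+ 2 ℤ.* + 0 - + 1))
      ≡⟨ cong (λ e → + (n + 1) - (+ suc n - e ℤ.* (+ 2 ℤ.* + 0 - + 1))) (sgn-flip s₀) ⟩
    + (n + 1) - (+ suc n - (-1ℤ ℤ.* d) ℤ.* (+ 2 ℤ.* + 0 - + 1))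
      ≡⟨ ring (+ n) d ⟩
    d ∎)
    where
    open ≡-Reasoning
    ring : ∀ n d → n ℤ.+ + 1 - (1ℤ ℤ.+ n - (-1ℤ ℤ.* d) ℤ.* (+ 2 ℤ.* + 0 - + 1)) ≡ d
    ring = ℤ-Solver.solve-∀

-- The play and the lower bound combined, for both signs of d

theorem3 : (n m : ℕ) → 1 ≤ m → m ≤ n → (d : ℤ) → d ≡ 1ℤ ⊎ d ≡ -1ℤ →
    IsOptimal (initial n m) (moves n m d) (final n m)
    × length (moves n m d) ≡ n * m + n + m
    × d ≡ + (n + 1) - x n m d 1
-- Writing n as m + l avoids truncated subtraction, and either sign d is `sgn` of a side.
theorem3 n m 1≤m m≤n d d≡±1 with m≤n⇒∃[o]m+o≡n m≤n
... | l , refl = direction d≡±1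
  where
  N-moves : length (moves (m + l) m d) ≡ numberOfMoves (m + l) m
  N-moves = length-applyUpTo (λ i → x (m + l) m d (suc i)) (numberOfMoves (m + l) m)

  result : ∀ s → d ≡ sgn s →
    IsOptimal (initial (m + l) m) (moves (m + l) m d) (final (m + l) m)
    × length (moves (m + l) m d) ≡ (m + l) * m + (m + l) + m
    × d ≡ + (m + l + 1) - x (m + l) m d 1
  result s refl =
    (Values.play m l s , λ ys play → ≤-trans (≤-reflexive N-moves) (play-length≥ (m + l) m (≤-trans 1≤m m≤n) 1≤m ys play)) ,
    N-moves ,
    Values.first-direction m l s 1≤m

  direction : d ≡ 1ℤ ⊎ d ≡ -1ℤ → _
  direction (inj₁ d≡1)  = result left d≡1
  direction (inj₂ d≡-1) = result right d≡-1
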